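{- Let $q$ be a transcendental complex number. Let $r$ and $s$ be integers with $s\neq 0$, and set $\alpha:=r/s$. Let $b$ be a positive integer, and set $c:=\gcd(r,s,b)$, $b':=b/c$ and $s':=s/c$. Let $n\in\mathbb Z$ be such that $(q^r;q^s)_n$ is well-defined and non-zero. Then $$ v_{\phi_b}\big((q^r;q^s)_n\big)=\begin{cases}\left\lfloor \dfrac{cn}{b}- D_{b'}(\alpha)-\dfrac{\lfloor 1-\alpha\rfloor}{b'}\right\rfloor+1 & \text{if } \gcd(s',b')=1,\\[2mm] 0 & \text{otherwise.}\end{cases} $$
   Context: For integers $r,s$ with $s\neq0$, the $q$-Pochhammer symbol is $(q^r;q^s)_n:=\prod_{i=0}^{n-1}(1-q^{r+si})$ for $n\geq 0$ (empty product $=1$ for $n=0$), and for $n<0$ it is $(q^r;q^s)_n:=\prod_{i=1}^{ -n}\frac{1}{1-q^{r-is}}$, which is well-defined when no factor $1-q^{r-is}$ vanishes. For a positive integer $b$, $\phi_b(q)\in\mathbb Z[q]$ is the $b$-th cyclotomic polynomial and $v_{\phi_b}$ is the associated valuation on $\mathbb Q(q)$: for nonzero $R\in\mathbb Z[q]$, $v_{\phi_b}(R)$ is the largest $\nu\geq0$ with $\phi_b^\nu\mid R$, extended by $v_{\phi_b}(R/S)=v_{\phi_b}(R)-v_{\phi_b}(S)$. Generalized Dwork map: for a positive integer $m$, let $S_m^{ -1}\mathbb Z$ be the set of rationals whose reduced denominator is coprime to $m$; for $\alpha\in S_m^{ -1}\mathbb Z$, $D_m(\alpha)$ is the unique element of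 $S_m^{ -1}\mathbb Z$ such that $mD_m(\alpha)-\alpha\in\{0,1,\dots,m-1\}$. (When $\gcd(s',b')=1$, $\alpha\in S_{b'}^{ -1}\mathbb Z$.) -}

module Defs where

open import Data.Nat as ℕ using (ℕ; zero; suc; _<_; _≤_)
open import Data.Nat.Divisibility using (_∣?_)
open import Data.Nat.Coprimality using (Coprime)
open import Data.Integer as ℤ using (ℤ; +_; -[1+_]; 0ℤ; 1ℤ)
open import Data.Rational as ℚ using (ℚ; 0ℚ; 1ℚ; ↧ₙ_)
open import Data.List using (List; []; _∷_; map; foldr; replicate; _++_; applyUpTo; filter)
open import Data.List.Relation.Unary.All using (All)
open import Data.Product using (_×_; _,_; proj₁; proj₂; ∃; Σ)
open import Relation.Nullary using (¬_)
open import Relation.Binary.PropositionalEquality using (_≡_)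

-- Polynomials in ℤ[q] as coefficient lists (constant term first).

Poly : Set
Poly = List ℤ

infixl 6 _+ₚ_
infixl 7 _*ₚ_

_+ₚ_ : Poly → Poly → Poly
[]      +ₚ q       = q
(a ∷ p) +ₚ []      = a ∷ p
(a ∷ p) +ₚ (b ∷ q) = (a ℤ.+ b) ∷ (p +ₚ q)

negₚ : Poly → Poly
negₚ = map (λ a → ℤ.- a)

scaleₚ : ℤ → Poly → Poly
scaleₚ a = map (a ℤ.*_)

_*ₚ_ : Poly → Poly → Poly
[]      *ₚ q = []
(a ∷ p) *ₚ q = scaleₚ a q +ₚ (0ℤ ∷ (p *ₚ q))

oneₚ : Poly
oneₚ = 1ℤ ∷ []

xpow : ℕ → Poly
xpow m = replicate m 0ℤ ++ (1ℤ ∷ [])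

prodₚ : List Poly → Poly
prodₚ = foldr _*ₚ_ oneₚ

powₚ : Poly → ℕ → Poly
powₚ p zero    = oneₚ
powₚ p (suc ν) = p *ₚ powₚ p ν

IsZeroₚ : Poly → Set
IsZeroₚ p = All (_≡ 0ℤ) p

_≈ₚ_ : Poly → Poly → Set
p ≈ₚ q = IsZeroₚ (p +ₚ negₚ q)

_∣ₚ_ : Poly → Poly → Set
d ∣ₚ p = ∃ λ e → (d *ₚ e) ≈ₚ p

-- Cyclotomic polynomials: the family (φ_n)_{n ≥ 1} with
--   ∏_{d ∣ n} φ_d = q^n - 1   for all n ≥ 1
-- (this determines every φ_n uniquely, recursively in n).

divisorsℕ : ℕ → List ℕ
divisorsℕ n = filter (λ d → d ∣? n) (applyUpTo suc n)

IsCyclotomicFamily : (ℕ → Poly) → Set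
IsCyclotomicFamily Φ =
  ∀ n → 1 ≤ n → prodₚ (map Φ (divisorsℕ n)) ≈ₚ (xpow n +ₚ negₚ oneₚ)

HasVal : Poly → Poly → ℕ → Set
HasVal φ R ν = (powₚ φ ν ∣ₚ R) × ¬ (powₚ φ (suc ν) ∣ₚ R)

-- An element of ℚ(q) represented as (numerator , denominator) with
-- numerator, denominator ∈ ℤ[q];  v(R/S) = v(R) - v(S).
ValFrac : Poly → Poly × Poly → ℤ → Set
ValFrac φ (R , S) v =
  Σ ℕ λ νR → Σ ℕ λ νS → HasVal φ R νR × HasVal φ S νS × (v ≡ (+ νR) ℤ.- (+ νS))

-- The factor 1 - q^e as a fraction in ℚ(q):
--   e = m ≥ 0     : (1 - q^m) / 1
--   e = -(m+1) < 0 : (q^(m+1) - 1) / q^(m+1)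
factor : ℤ → Poly × Poly
factor (+ m)    = (oneₚ +ₚ negₚ (xpow m)) , oneₚ
factor -[1+ m ] = (xpow (suc m) +ₚ negₚ oneₚ) , xpow (suc m)

-- exponents e of the factors (1 - q^e) occurring in (q^r;q^s)_n
--   n ≥ 0 : r + s i,  i = 0 .. n-1   (in the numerator)
--   n < 0 : r - i s,  i = 1 .. -n    (in the denominator)
pexps : ℤ → ℤ → ℤ → List ℤ
pexps r s (+ k)    = applyUpTo (λ i → r ℤ.+ s ℤ.* (+ i)) k
pexps r s -[1+ k ] = applyUpTo (λ i → r ℤ.- (+ suc i) ℤ.* s) (suc k)

poch : ℤ → ℤ → ℤ → Poly × Poly
poch r s n with map factor (pexps r s n)
... | fs with n
...   | + _      = prodₚ (map proj₁ fs) , prodₚ (map proj₂ fs)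
...   | -[1+ _ ] = prodₚ (map proj₂ fs) , prodₚ (map proj₁ fs)

PochDefinedNonzero : ℤ → ℤ → ℤ → Set
PochDefinedNonzero r s n = All (λ e → ¬ IsZeroₚ (proj₁ (factor e))) (pexps r s n)

-- x / d in ℚ, with the (unused) convention x / 0 = 0
_÷_ : ℤ → ℕ → ℚ
x ÷ zero  = 0ℚ
x ÷ suc k = x ℚ./ suc k

-- the rational number r / s (s ≠ 0; convention r/0 = 0)
ratio : ℤ → ℤ → ℚ
ratio r (+ k)    = r ÷ k
ratio r -[1+ k ] = (ℤ.- r) ÷ suc k

-- Generalized Dwork map: D is D_m(α), i.e. D ∈ S_m^{-1}ℤ (reduced
-- denominator coprime to m) and m·D - α ∈ {0, 1, …, m-1}.
IsDwork : ℕ → ℚ → ℚ → Set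
IsDwork m α D =
  Coprime (↧ₙ D) m × (∃ λ k → (k < m) × (((+ m) ℚ./ 1) ℚ.* D ℚ.- α ≡ (+ k) ℚ./ 1))

{-# OPTIONS --safe #-}
module Submission where

-- For e ≠ 0 the polynomial φ = φ_b divides q^e - 1 exactly once if b ∣ e and not at all
-- otherwise, so the valuation is ± the number of exponents divisible by b.  Irreducibility of φ is
-- not needed: it suffices that the complementary factors are non-zero-divisors modulo φ over ℚ.
-- For the cofactor of φ in q^e - 1 this holds because q^e - 1 is coprime to its derivative; hence
-- it holds for every φ_d with d ∣ b, d ≠ b, hence for q^g - 1 with g a proper divisor of b, and
-- hence for q^e - 1 with b ∤ e, since q^gcd(b,e) - 1 lies in the ideal (q^b - 1, q^e - 1).
-- That φ is not constant follows from Σ_{d ∣ n} deg φ_d = n alone.  Finally, with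
-- k = b′ D(α) - α, the exponent r + s j is divisible by b iff j ≡ k mod b′, so the signed count
-- over [0, n) is ⌊(n - k - 1) / b′⌋ + 1.

open import Defs
open import Algebra.Bundles using (CommutativeRing)
open import Data.Bool using (if_then_else_)
open import Data.Empty using (⊥-elim)
open import Data.Integer as ℤ using (ℤ; +_; -[1+_]; 0ℤ; 1ℤ; ∣_∣)
open import Data.Integer.DivMod using (_/ℕ_)
import Data.Integer.DivMod as ℤD
import Data.Integer.Divisibility.Signed as ℤ∣
import Data.Integer.Properties as ℤP
import Data.Integer.Tactic.RingSolver as ℤSolver
open import Data.List using (List; []; _∷_; _++_; map; applyUpTo)
open import Data.List.Membership.Propositional using (_∈_)
open import Data.List.Membership.Propositional.Properties
  using (∈-filter⁺; ∈-filter⁻; ∈-applyUpTo⁺; ∈-applyUpTo⁻; ∈-map⁺; ∈-map⁻; ∈-++⁺ˡ; ∈-++⁺ʳ; ∈-++⁻)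
open import Data.List.Membership.Propositional.Properties.WithK using (unique∧set⇒bag)
open import Data.List.Properties using (map-++; map-∘)
open import Data.List.Relation.Binary.BagAndSetEquality using (∼bag⇒↭)
open import Data.List.Relation.Binary.Permutation.Propositional using (_↭_)
import Data.List.Relation.Binary.Permutation.Propositional.Properties as Perm
open import Data.List.Relation.Unary.All using (All; []; _∷_)
open import Data.List.Relation.Unary.Any using (here; there)
open import Data.List.Relation.Unary.Unique.Propositional using (Unique)
import Data.List.Relation.Unary.Unique.Propositional.Properties as Unique
open import Data.Maybe using (Maybe; just; nothing)
open import Data.Nat as ℕ using (ℕ; zero; suc; 2+; _+_; _*_; _^_; _≤_; _<_; z≤n; s≤s;
  NonZero; >-nonZero; >-nonZero⁻¹; ≢-nonZero; nonTrivial⇒n>1)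
open import Data.Nat.Coprimality as Coprimality using (Coprime; coprime-divisor)
open import Data.Nat.Divisibility as ℕD using (_∣_; divides; _∣?_)
open import Data.Nat.GCD as G using (gcd; gcd-greatest; gcd[m,n]∣m)
open import Data.Nat.Induction using (<-wellFounded; Acc; acc)
open import Data.Nat.ListAction using (sum; product)
open import Data.Nat.ListAction.Properties using (sum-++; sum-↭)
open import Data.Nat.Primality using (Prime; prime⇒nonZero; prime⇒nonTrivial; prime⇒irreducible)
open import Data.Nat.Primality.Factorisation using (factorise)
import Data.Nat.Properties as ℕP
import Data.Nat.Tactic.RingSolver as ℕSolver
open import Data.Product using (_×_; _,_; proj₁; proj₂; ∃; ∃₂)
open import Data.Rational as ℚ using (ℚ; mkℚ; 1ℚ; floor; ↥_; ↧_; ↧ₙ_; toℚᵘ)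
import Data.Rational.Properties as ℚP
open import Data.Rational.Unnormalised as ℚᵘ using (mkℚᵘ; *≡*)
import Data.Rational.Unnormalised.Properties as ℚᵘP
open import Data.Sum using (_⊎_; inj₁; inj₂; [_,_]′)
open import Function using (_∘_; id; mk⇔)
open import Level using (0ℓ)
open import Relation.Binary.PropositionalEquality
open import Relation.Binary.Structures using (IsEquivalence)
open import Relation.Nullary using (¬_; does; yes; no)
open import Relation.Nullary.Decidable using (dec-true; dec-false; dec⇒maybe)
open import Tactic.RingSolver.Core.AlmostCommutativeRing using (AlmostCommutativeRing; fromCommutativeRing)
import Tactic.RingSolver as RS
import Relation.Binary.Reasoning.Setoid ℚᵘP.≃-setoid as ≃-Reasoning

-- The ring ℤ[q]

-- The family `Φ` is given only by its product identity, so the degree of `Φ b` has to be derived.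
-- Positive degree matters because a valuation exists only for a non-unit: every power of a unit
-- divides everything. Non-divisibility by φ is preserved by products only if φ is prime, whereas
-- non-zero-divisors modulo φ are closed under products for every φ. This is why a regular cofactor
-- is carried along instead of the bare statement about powers of φ. The denominators N enter
-- because the derivative identity produces the constant e and not 1: from φ ∣ u x it yields only φ
-- ∣ e x. They do no harm in the end, since a non-constant φ divides no non-zero integer.

coeff : Poly → ℕ → ℤ
coeff []      _       = 0ℤ
coeff (a ∷ p) zero    = a
coeff (a ∷ p) (suc k) = coeff p k

infix 4 _≋_

-- A record rather than a Π-type, so that the two polynomials can be inferred.
record _≋_ (p q : Poly) : Set where
  constructor mk≋
  field
    at : ∀ k → coeff p k ≡ coeff q k

open _≋_ public

coeff-+ : ∀ p q k → coeff (p +ₚ q) k ≡ coeff p k ℤ.+ coeff q k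
coeff-+ []      q       k       = sym (ℤP.+-identityˡ _)
coeff-+ (a ∷ p) []      k       = sym (ℤP.+-identityʳ _)
coeff-+ (a ∷ p) (b ∷ q) zero    = refl
coeff-+ (a ∷ p) (b ∷ q) (suc k) = coeff-+ p q k

coeff-neg : ∀ p k → coeff (negₚ p) k ≡ ℤ.- coeff p k
coeff-neg []      k       = refl
coeff-neg (a ∷ p) zero    = refl
coeff-neg (a ∷ p) (suc k) = coeff-neg p k

coeff-scale : ∀ a p k → coeff (scaleₚ a p) k ≡ a ℤ.* coeff p k
coeff-scale a []      k       = sym (ℤP.*-zeroʳ a)
coeff-scale a (b ∷ p) zero    = refl
coeff-scale a (b ∷ p) (suc k) = coeff-scale a p k

coeff-*-zero : ∀ a p q → coeff ((a ∷ p) *ₚ q) 0 ≡ a ℤ.* coeff q 0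
coeff-*-zero a p q = begin
  coeff (scaleₚ a q +ₚ (0ℤ ∷ (p *ₚ q))) 0 ≡⟨ coeff-+ (scaleₚ a q) _ 0 ⟩
  coeff (scaleₚ a q) 0 ℤ.+ 0ℤ             ≡⟨ ℤP.+-identityʳ _ ⟩
  coeff (scaleₚ a q) 0                    ≡⟨ coeff-scale a q 0 ⟩
  a ℤ.* coeff q 0                         ∎
  where open ≡-Reasoning

coeff-*-suc : ∀ a p q k →
  coeff ((a ∷ p) *ₚ q) (suc k) ≡ a ℤ.* coeff q (suc k) ℤ.+ coeff (p *ₚ q) k
coeff-*-suc a p q k = trans (coeff-+ (scaleₚ a q) _ (suc k))
  (cong (ℤ._+ coeff (p *ₚ q) k) (coeff-scale a q (suc k)))

coeff-*-[] : ∀ p k → coeff (p *ₚ []) k ≡ 0ℤ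
coeff-*-[] []      k       = refl
coeff-*-[] (a ∷ p) zero    = refl
coeff-*-[] (a ∷ p) (suc k) = coeff-*-[] p k

coeff-*∷-zero : ∀ p b q → coeff (p *ₚ (b ∷ q)) 0 ≡ b ℤ.* coeff p 0
coeff-*∷-zero []      b q = sym (ℤP.*-zeroʳ b)
coeff-*∷-zero (a ∷ p) b q = trans (coeff-*-zero a p (b ∷ q)) (ℤP.*-comm a b)

-- `_*ₚ_` recurses on its left factor only, so commutativity needs this mirror image of
-- `coeff-*-suc`: the expansion along the right factor, by induction on the left one.
coeff-*∷-suc : ∀ p b q k →
  coeff (p *ₚ (b ∷ q)) (suc k) ≡ b ℤ.* coeff p (suc k) ℤ.+ coeff (p *ₚ q) k
coeff-*∷-suc [] b q k = sym (trans (ℤP.+-identityʳ _) (ℤP.*-zeroʳ b))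
coeff-*∷-suc (a ∷ p) b q zero = begin
  coeff ((a ∷ p) *ₚ (b ∷ q)) 1                    ≡⟨ coeff-*-suc a p (b ∷ q) 0 ⟩
  a ℤ.* coeff q 0 ℤ.+ coeff (p *ₚ (b ∷ q)) 0      ≡⟨ ℤP.+-comm (a ℤ.* coeff q 0) _ ⟩
  coeff (p *ₚ (b ∷ q)) 0 ℤ.+ a ℤ.* coeff q 0      ≡⟨ cong₂ ℤ._+_ (coeff-*∷-zero p b q) (sym (coeff-*-zero a p q)) ⟩
  b ℤ.* coeff p 0 ℤ.+ coeff ((a ∷ p) *ₚ q) 0      ∎
  where open ≡-Reasoning
coeff-*∷-suc (a ∷ p) b q (suc k) = begin
  coeff ((a ∷ p) *ₚ (b ∷ q)) (suc (suc k))                    ≡⟨ coeff-*-suc a p (b ∷ q) (suc k) ⟩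
  x ℤ.+ coeff (p *ₚ (b ∷ q)) (suc k)                          ≡⟨ cong (ℤ._+_ x) (coeff-*∷-suc p b q k) ⟩
  x ℤ.+ (y ℤ.+ z)                                             ≡⟨ swap x y z ⟩
  y ℤ.+ (x ℤ.+ z)                                             ≡⟨ cong (ℤ._+_ y) (coeff-*-suc a p q k) ⟨
  y ℤ.+ coeff ((a ∷ p) *ₚ q) (suc k)                          ∎
  where
  open ≡-Reasoning
  x = a ℤ.* coeff q (suc k)
  y = b ℤ.* coeff p (suc k)
  z = coeff (p *ₚ q) k
  swap : ∀ x y z → x ℤ.+ (y ℤ.+ z) ≡ y ℤ.+ (x ℤ.+ z)
  swap = ℤSolver.solve-∀

coeff-*-comm : ∀ p q k → coeff (p *ₚ q) k ≡ coeff (q *ₚ p) k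
coeff-*-comm []      q k       = sym (coeff-*-[] q k)
coeff-*-comm (a ∷ p) q zero    = trans (coeff-*-zero a p q) (sym (coeff-*∷-zero q a p))
coeff-*-comm (a ∷ p) q (suc k) = begin
  coeff ((a ∷ p) *ₚ q) (suc k)                     ≡⟨ coeff-*-suc a p q k ⟩
  a ℤ.* coeff q (suc k) ℤ.+ coeff (p *ₚ q) k       ≡⟨ cong (ℤ._+_ (a ℤ.* coeff q (suc k))) (coeff-*-comm p q k) ⟩
  a ℤ.* coeff q (suc k) ℤ.+ coeff (q *ₚ p) k       ≡⟨ coeff-*∷-suc q a p k ⟨
  coeff (q *ₚ (a ∷ p)) (suc k)                     ∎
  where open ≡-Reasoning

coeff-*-cong : ∀ p {q r} → q ≋ r → ∀ k → coeff (p *ₚ q) k ≡ coeff (p *ₚ r) k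
coeff-*-cong []              e k       = refl
coeff-*-cong (a ∷ p) {q} {r} e zero    =
  trans (coeff-*-zero a p q) (trans (cong (a ℤ.*_) (at e 0)) (sym (coeff-*-zero a p r)))
coeff-*-cong (a ∷ p) {q} {r} e (suc k) = trans (coeff-*-suc a p q k)
  (trans (cong₂ ℤ._+_ (cong (a ℤ.*_) (at e (suc k))) (coeff-*-cong p e k)) (sym (coeff-*-suc a p r k)))

coeff-*-distribˡ : ∀ p q r k →
  coeff (p *ₚ (q +ₚ r)) k ≡ coeff (p *ₚ q) k ℤ.+ coeff (p *ₚ r) k
coeff-*-distribˡ []      q r k    = refl
coeff-*-distribˡ (a ∷ p) q r zero = begin
  coeff ((a ∷ p) *ₚ (q +ₚ r)) 0                    ≡⟨ coeff-*-zero a p (q +ₚ r) ⟩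
  a ℤ.* coeff (q +ₚ r) 0                           ≡⟨ cong (a ℤ.*_) (coeff-+ q r 0) ⟩
  a ℤ.* (coeff q 0 ℤ.+ coeff r 0)                  ≡⟨ ℤP.*-distribˡ-+ a _ _ ⟩
  a ℤ.* coeff q 0 ℤ.+ a ℤ.* coeff r 0              ≡⟨ cong₂ ℤ._+_ (coeff-*-zero a p q) (coeff-*-zero a p r) ⟨
  coeff ((a ∷ p) *ₚ q) 0 ℤ.+ coeff ((a ∷ p) *ₚ r) 0 ∎
  where open ≡-Reasoning
coeff-*-distribˡ (a ∷ p) q r (suc k) = begin
  coeff ((a ∷ p) *ₚ (q +ₚ r)) (suc k)                                ≡⟨ coeff-*-suc a p (q +ₚ r) k ⟩
  a ℤ.* coeff (q +ₚ r) (suc k) ℤ.+ coeff (p *ₚ (q +ₚ r)) k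
    ≡⟨ cong₂ (λ u v → a ℤ.* u ℤ.+ v) (coeff-+ q r (suc k)) (coeff-*-distribˡ p q r k) ⟩
  a ℤ.* (x ℤ.+ y) ℤ.+ (z ℤ.+ w)                                      ≡⟨ shuffle a x y z w ⟩
  (a ℤ.* x ℤ.+ z) ℤ.+ (a ℤ.* y ℤ.+ w)                                ≡⟨ cong₂ ℤ._+_ (coeff-*-suc a p q k) (coeff-*-suc a p r k) ⟨
  coeff ((a ∷ p) *ₚ q) (suc k) ℤ.+ coeff ((a ∷ p) *ₚ r) (suc k)      ∎
  where
  open ≡-Reasoning
  x = coeff q (suc k)
  y = coeff r (suc k)
  z = coeff (p *ₚ q) k
  w = coeff (p *ₚ r) k
  shuffle : ∀ a x y z w → a ℤ.* (x ℤ.+ y) ℤ.+ (z ℤ.+ w) ≡ (a ℤ.* x ℤ.+ z) ℤ.+ (a ℤ.* y ℤ.+ w)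
  shuffle = ℤSolver.solve-∀

coeff-*-distribʳ : ∀ r p q k →
  coeff ((p +ₚ q) *ₚ r) k ≡ coeff (p *ₚ r) k ℤ.+ coeff (q *ₚ r) k
coeff-*-distribʳ r p q k = begin
  coeff ((p +ₚ q) *ₚ r) k                  ≡⟨ coeff-*-comm (p +ₚ q) r k ⟩
  coeff (r *ₚ (p +ₚ q)) k                  ≡⟨ coeff-*-distribˡ r p q k ⟩
  coeff (r *ₚ p) k ℤ.+ coeff (r *ₚ q) k    ≡⟨ cong₂ ℤ._+_ (coeff-*-comm r p k) (coeff-*-comm r q k) ⟩
  coeff (p *ₚ r) k ℤ.+ coeff (q *ₚ r) k    ∎
  where open ≡-Reasoning

coeff-scale-* : ∀ a p q k → coeff (scaleₚ a p *ₚ q) k ≡ a ℤ.* coeff (p *ₚ q) k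
coeff-scale-* a []      q k    = sym (ℤP.*-zeroʳ a)
coeff-scale-* a (b ∷ p) q zero = begin
  coeff (scaleₚ a (b ∷ p) *ₚ q) 0      ≡⟨ coeff-*-zero (a ℤ.* b) (scaleₚ a p) q ⟩
  a ℤ.* b ℤ.* coeff q 0                ≡⟨ ℤP.*-assoc a b _ ⟩
  a ℤ.* (b ℤ.* coeff q 0)              ≡⟨ cong (a ℤ.*_) (coeff-*-zero b p q) ⟨
  a ℤ.* coeff ((b ∷ p) *ₚ q) 0         ∎
  where open ≡-Reasoning
coeff-scale-* a (b ∷ p) q (suc k) = begin
  coeff (scaleₚ a (b ∷ p) *ₚ q) (suc k)                         ≡⟨ coeff-*-suc (a ℤ.* b) (scaleₚ a p) q k ⟩
  a ℤ.* b ℤ.* coeff q (suc k) ℤ.+ coeff (scaleₚ a p *ₚ q) k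
    ≡⟨ cong₂ ℤ._+_ (ℤP.*-assoc a b _) (coeff-scale-* a p q k) ⟩
  a ℤ.* (b ℤ.* coeff q (suc k)) ℤ.+ a ℤ.* coeff (p *ₚ q) k      ≡⟨ ℤP.*-distribˡ-+ a _ _ ⟨
  a ℤ.* (b ℤ.* coeff q (suc k) ℤ.+ coeff (p *ₚ q) k)            ≡⟨ cong (a ℤ.*_) (coeff-*-suc b p q k) ⟨
  a ℤ.* coeff ((b ∷ p) *ₚ q) (suc k)                            ∎
  where open ≡-Reasoning

coeff-*-assoc : ∀ p q r k → coeff ((p *ₚ q) *ₚ r) k ≡ coeff (p *ₚ (q *ₚ r)) k
coeff-*-assoc []      q r k    = refl
coeff-*-assoc (a ∷ p) q r zero = begin
  coeff ((scaleₚ a q +ₚ (0ℤ ∷ (p *ₚ q))) *ₚ r) 0     ≡⟨ coeff-*-distribʳ r (scaleₚ a q) _ 0 ⟩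
  coeff (scaleₚ a q *ₚ r) 0 ℤ.+ coeff ((0ℤ ∷ (p *ₚ q)) *ₚ r) 0
    ≡⟨ cong₂ ℤ._+_ (coeff-scale-* a q r 0) (coeff-*-zero 0ℤ (p *ₚ q) r) ⟩
  a ℤ.* coeff (q *ₚ r) 0 ℤ.+ 0ℤ                      ≡⟨ ℤP.+-identityʳ _ ⟩
  a ℤ.* coeff (q *ₚ r) 0                             ≡⟨ coeff-*-zero a p (q *ₚ r) ⟨
  coeff ((a ∷ p) *ₚ (q *ₚ r)) 0                      ∎
  where open ≡-Reasoning
coeff-*-assoc (a ∷ p) q r (suc k) = begin
  coeff ((scaleₚ a q +ₚ (0ℤ ∷ (p *ₚ q))) *ₚ r) (suc k)     ≡⟨ coeff-*-distribʳ r (scaleₚ a q) _ (suc k) ⟩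
  coeff (scaleₚ a q *ₚ r) (suc k) ℤ.+ coeff ((0ℤ ∷ (p *ₚ q)) *ₚ r) (suc k)
    ≡⟨ cong₂ ℤ._+_ (coeff-scale-* a q r (suc k)) (coeff-*-suc 0ℤ (p *ₚ q) r k) ⟩
  a ℤ.* coeff (q *ₚ r) (suc k) ℤ.+ (0ℤ ℤ.+ coeff ((p *ₚ q) *ₚ r) k)
    ≡⟨ cong (ℤ._+_ (a ℤ.* coeff (q *ₚ r) (suc k))) (trans (ℤP.+-identityˡ _) (coeff-*-assoc p q r k)) ⟩
  a ℤ.* coeff (q *ₚ r) (suc k) ℤ.+ coeff (p *ₚ (q *ₚ r)) k ≡⟨ coeff-*-suc a p (q *ₚ r) k ⟨
  coeff ((a ∷ p) *ₚ (q *ₚ r)) (suc k)                      ∎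
  where open ≡-Reasoning

coeff-*-identityˡ : ∀ p k → coeff (oneₚ *ₚ p) k ≡ coeff p k
coeff-*-identityˡ p zero    = trans (coeff-*-zero 1ℤ [] p) (ℤP.*-identityˡ _)
coeff-*-identityˡ p (suc k) = trans (coeff-*-suc 1ℤ [] p k) (trans (ℤP.+-identityʳ _) (ℤP.*-identityˡ _))

-- The laws hold only coefficientwise: for non-empty `p`, the sum `p +ₚ negₚ p` is a list of zeros
-- and not `[]`.
Poly-commutativeRing : CommutativeRing 0ℓ 0ℓ
Poly-commutativeRing = record
  { Carrier = Poly ; _≈_ = _≋_ ; _+_ = _+ₚ_ ; _*_ = _*ₚ_ ; -_ = negₚ ; 0# = [] ; 1# = oneₚ
  ; isCommutativeRing = record
    { isRing = record
      { +-isAbelianGroup = record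
        { isGroup = record
          { isMonoid = record
            { isSemigroup = record
              { isMagma = record
                { isEquivalence = ≋-isEquivalence
                ; ∙-cong = λ {p} {p′} {q} {q′} e f → mk≋ λ k →
                    trans (coeff-+ p q k) (trans (cong₂ ℤ._+_ (at e k) (at f k)) (sym (coeff-+ p′ q′ k)))
                }
              ; assoc = λ p q r → mk≋ λ k → begin
                  coeff ((p +ₚ q) +ₚ r) k                   ≡⟨ coeff-+ (p +ₚ q) r k ⟩
                  coeff (p +ₚ q) k ℤ.+ coeff r k            ≡⟨ cong (ℤ._+ coeff r k) (coeff-+ p q k) ⟩
                  coeff p k ℤ.+ coeff q k ℤ.+ coeff r k     ≡⟨ ℤP.+-assoc (coeff p k) _ _ ⟩
                  coeff p k ℤ.+ (coeff q k ℤ.+ coeff r k)   ≡⟨ cong (ℤ._+_ (coeff p k)) (coeff-+ q r k) ⟨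
                  coeff p k ℤ.+ coeff (q +ₚ r) k            ≡⟨ coeff-+ p (q +ₚ r) k ⟨
                  coeff (p +ₚ (q +ₚ r)) k                   ∎
              }
            ; identity = (λ p → mk≋ λ k → refl)
                       , (λ p → mk≋ λ k → trans (coeff-+ p [] k) (ℤP.+-identityʳ _))
            }
          ; inverse = (λ p → mk≋ λ k → trans (coeff-+ (negₚ p) p k)
                        (trans (cong (ℤ._+ coeff p k) (coeff-neg p k)) (ℤP.+-inverseˡ (coeff p k))))
                    , (λ p → mk≋ λ k → trans (coeff-+ p (negₚ p) k)
                        (trans (cong (ℤ._+_ (coeff p k)) (coeff-neg p k)) (ℤP.+-inverseʳ (coeff p k))))
          ; ⁻¹-cong = λ {p} {q} e → mk≋ λ k →
              trans (coeff-neg p k) (trans (cong ℤ.-_ (at e k)) (sym (coeff-neg q k)))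
          }
        ; comm = λ p q → mk≋ λ k →
            trans (coeff-+ p q k) (trans (ℤP.+-comm (coeff p k) _) (sym (coeff-+ q p k)))
        }
      ; *-cong = λ {p} {p′} {q} {q′} e f → mk≋ λ k → begin
          coeff (p *ₚ q) k     ≡⟨ coeff-*-cong p f k ⟩
          coeff (p *ₚ q′) k    ≡⟨ coeff-*-comm p q′ k ⟩
          coeff (q′ *ₚ p) k    ≡⟨ coeff-*-cong q′ e k ⟩
          coeff (q′ *ₚ p′) k   ≡⟨ coeff-*-comm q′ p′ k ⟩
          coeff (p′ *ₚ q′) k   ∎
      ; *-assoc = λ p q r → mk≋ (coeff-*-assoc p q r)
      ; *-identity = (λ p → mk≋ (coeff-*-identityˡ p))
                   , (λ p → mk≋ λ k → trans (coeff-*-comm p oneₚ k) (coeff-*-identityˡ p k))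
      ; distrib = (λ p q r → mk≋ λ k → trans (coeff-*-distribˡ p q r k) (sym (coeff-+ (p *ₚ q) (p *ₚ r) k)))
                , (λ r p q → mk≋ λ k → trans (coeff-*-distribʳ r p q k) (sym (coeff-+ (p *ₚ r) (q *ₚ r) k)))
      }
    ; *-comm = λ p q → mk≋ (coeff-*-comm p q)
    }
  }
  where
  open ≡-Reasoning
  ≋-isEquivalence : IsEquivalence _≋_
  ≋-isEquivalence = record
    { refl  = mk≋ λ _ → refl
    ; sym   = λ e → mk≋ λ k → sym (at e k)
    ; trans = λ e f → mk≋ λ k → trans (at e k) (at f k)
    }

module ℙ = CommutativeRing Poly-commutativeRing

import Relation.Binary.Reasoning.Setoid ℙ.setoid as ≋-Reasoning

0≋? : ∀ p → Maybe ([] ≋ p)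
0≋? []      = just ℙ.refl
0≋? (a ∷ p) with 0ℤ ℤ.≟ a | 0≋? p
... | yes 0≡a | just 0≋p = just (mk≋ λ { zero → 0≡a ; (suc k) → at 0≋p k })
... | _       | _        = nothing

poly-ring : AlmostCommutativeRing 0ℓ 0ℓ
poly-ring = fromCommutativeRing Poly-commutativeRing 0≋?

IsZeroₚ⇒coeff≡0 : ∀ {p} → IsZeroₚ p → ∀ k → coeff p k ≡ 0ℤ
IsZeroₚ⇒coeff≡0 []       k       = refl
IsZeroₚ⇒coeff≡0 (z ∷ zs) zero    = z
IsZeroₚ⇒coeff≡0 (z ∷ zs) (suc k) = IsZeroₚ⇒coeff≡0 zs k

coeff≡0⇒IsZeroₚ : ∀ p → (∀ k → coeff p k ≡ 0ℤ) → IsZeroₚ p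
coeff≡0⇒IsZeroₚ []      z = []
coeff≡0⇒IsZeroₚ (a ∷ p) z = z 0 ∷ coeff≡0⇒IsZeroₚ p (z ∘ suc)

coeff-minus : ∀ p q k → coeff (p +ₚ negₚ q) k ≡ coeff p k ℤ.- coeff q k
coeff-minus p q k = trans (coeff-+ p (negₚ q) k) (cong (ℤ._+_ (coeff p k)) (coeff-neg q k))

≈ₚ⇒≋ : ∀ {p q} → p ≈ₚ q → p ≋ q
≈ₚ⇒≋ {p} {q} z = mk≋ λ k → ℤP.i-j≡0⇒i≡j _ _ (trans (sym (coeff-minus p q k)) (IsZeroₚ⇒coeff≡0 z k))

≋⇒≈ₚ : ∀ {p q} → p ≋ q → p ≈ₚ q
≋⇒≈ₚ {p} {q} e = coeff≡0⇒IsZeroₚ _ λ k → trans (coeff-minus p q k) (ℤP.i≡j⇒i-j≡0 (at e k))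

-- Degrees and the derivative

record HasDegree (p : Poly) (n : ℕ) : Set where
  constructor mkDegree
  field
    leading≢0 : coeff p n ≢ 0ℤ
    above≡0   : ∀ k → n ℕ.< k → coeff p k ≡ 0ℤ

open HasDegree

degree-unique : ∀ {p m n} → HasDegree p m → HasDegree p n → m ≡ n
degree-unique {p} {m} {n} (mkDegree l a) (mkDegree l′ a′) = ℕP.≤-antisym
  (ℕP.≮⇒≥ (λ n<m → l (a′ m n<m))) (ℕP.≮⇒≥ (λ m<n → l′ (a n m<n)))

degree-resp-≋ : ∀ {p q n} → p ≋ q → HasDegree p n → HasDegree q n
degree-resp-≋ {n = n} e (mkDegree l a) =
  mkDegree (l ∘ trans (at e n)) (λ k n<k → trans (sym (at e k)) (a k n<k))

zero-or-degree : ∀ p → p ≋ [] ⊎ ∃ (HasDegree p)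
zero-or-degree [] = inj₁ ℙ.refl
zero-or-degree (a ∷ p) with zero-or-degree p
... | inj₂ (n , mkDegree l h) = inj₂ (suc n , mkDegree l λ { (suc k) (s≤s n<k) → h k n<k })
... | inj₁ p≋0 with a ℤ.≟ 0ℤ
...   | yes a≡0 = inj₁ (mk≋ λ { zero → a≡0 ; (suc k) → at p≋0 k })
...   | no  a≢0 = inj₂ (0 , mkDegree a≢0 λ { (suc k) _ → at p≋0 k })

coeff-*-top : ∀ p q m n → (∀ k → m ℕ.< k → coeff p k ≡ 0ℤ) → (∀ k → n ℕ.< k → coeff q k ≡ 0ℤ) →
  coeff (p *ₚ q) (m ℕ.+ n) ≡ coeff p m ℤ.* coeff q n × (∀ k → m ℕ.+ n ℕ.< k → coeff (p *ₚ q) k ≡ 0ℤ)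
coeff-*-top []      q m n hp hq = refl , λ _ _ → refl
coeff-*-top (a ∷ p) q zero n hp hq = top n , above
  where
  tail≋0 : p ≋ []
  tail≋0 = mk≋ λ k → hp (suc k) (s≤s z≤n)
  top : ∀ k → coeff ((a ∷ p) *ₚ q) k ≡ a ℤ.* coeff q k
  top zero    = coeff-*-zero a p q
  top (suc k) = trans (coeff-*-suc a p q k)
    (trans (cong (ℤ._+_ (a ℤ.* coeff q (suc k))) (at (ℙ.*-congʳ {q} tail≋0) k)) (ℤP.+-identityʳ _))
  above : ∀ k → n ℕ.< k → coeff ((a ∷ p) *ₚ q) k ≡ 0ℤ
  above k n<k = trans (top k) (trans (cong (a ℤ.*_) (hq k n<k)) (ℤP.*-zeroʳ a))
coeff-*-top (a ∷ p) q (suc m) n hp hq with coeff-*-top p q m n (λ k m<k → hp (suc k) (s≤s m<k)) hq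
... | top , above = step (m ℕ.+ n) (ℕP.m≤n+m n m) top ,
                    λ { (suc k) (s≤s m+n<k) → step k (ℕP.≤-trans (ℕP.m≤n+m n m) (ℕP.<⇒≤ m+n<k)) (above k m+n<k) }
  where
  step : ∀ k {x} → n ℕ.≤ k → coeff (p *ₚ q) k ≡ x → coeff ((a ∷ p) *ₚ q) (suc k) ≡ x
  step k n≤k e = trans (coeff-*-suc a p q k) (trans
    (cong₂ ℤ._+_ (trans (cong (a ℤ.*_) (hq (suc k) (s≤s n≤k))) (ℤP.*-zeroʳ a)) e) (ℤP.+-identityˡ _))

degree-* : ∀ {p q m n} → HasDegree p m → HasDegree q n → HasDegree (p *ₚ q) (m ℕ.+ n)
degree-* {p} {q} {m} {n} (mkDegree l a) (mkDegree l′ a′) with coeff-*-top p q m n a a′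
... | top , above = mkDegree
  (λ z → [ l , l′ ]′ (ℤP.i*j≡0⇒i≡0∨j≡0 (coeff p m) (trans (sym top) z))) above

degree⇒≉0 : ∀ {p n} → HasDegree p n → ¬ p ≋ []
degree⇒≉0 {n = n} d p≋0 = leading≢0 d (at p≋0 n)

≉0⇒degree : ∀ {p} → ¬ p ≋ [] → ∃ (HasDegree p)
≉0⇒degree {p} p≉0 = [ ⊥-elim ∘ p≉0 , id ]′ (zero-or-degree p)

p*q≋0⇒q≋0 : ∀ {p q} → ¬ p ≋ [] → p *ₚ q ≋ [] → q ≋ []
p*q≋0⇒q≋0 {p} {q} p≉0 e with zero-or-degree q
... | inj₁ q≋0     = q≋0
... | inj₂ (n , d) = ⊥-elim (degree⇒≉0 (degree-* (proj₂ (≉0⇒degree p≉0)) d) e)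

*ₚ-cancelˡ : ∀ {p q r} → ¬ p ≋ [] → p *ₚ q ≋ p *ₚ r → q ≋ r
*ₚ-cancelˡ {p} {q} {r} p≉0 e = mk≋ λ k → ℤP.i-j≡0⇒i≡j _ _ (trans (sym (coeff-minus q r k)) (at q-r≋0 k))
  where
  distrib : ∀ x y z → x *ₚ (y +ₚ negₚ z) ≋ x *ₚ y +ₚ negₚ (x *ₚ z)
  distrib = RS.solve-∀ poly-ring
  q-r≋0 : q +ₚ negₚ r ≋ []
  q-r≋0 = p*q≋0⇒q≋0 p≉0 (ℙ.trans (distrib p q r) (ℙ.trans (ℙ.+-congʳ e) (ℙ.-‿inverseʳ (p *ₚ r))))

-- The default 0 for the zero polynomial is harmless: a value of at least 1, as required by
-- `positive-degree`, already excludes that case.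
degree : Poly → ℕ
degree p = [ (λ _ → 0) , proj₁ ]′ (zero-or-degree p)

positive-degree : ∀ p → 1 ℕ.≤ degree p → ∃ λ n → HasDegree p (suc n)
positive-degree p 1≤deg with zero-or-degree p
... | inj₂ (suc n , d) = n , d

-- A product that has a degree is non-zero, which rules out vanishing factors; the degrees of the
-- factors then add because ℤ has no zero divisors.
degree-prodₚ : ∀ {A : Set} (f : A → Poly) xs {n} → HasDegree (prodₚ (map f xs)) n →
  sum (map (degree ∘ f) xs) ≡ n
degree-prodₚ f []       d = degree-unique (mkDegree {oneₚ} {0} (λ ()) (λ { (suc k) _ → refl })) d
degree-prodₚ f (x ∷ xs) d with zero-or-degree (f x) | zero-or-degree (prodₚ (map f xs))
... | inj₁ fx≋0 | _ = ⊥-elim (degree⇒≉0 d (ℙ.trans (ℙ.*-congʳ {prodₚ (map f xs)} fx≋0) (ℙ.zeroˡ (prodₚ (map f xs)))))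
... | inj₂ _ | inj₁ rest≋0 = ⊥-elim (degree⇒≉0 d (ℙ.trans (ℙ.*-congˡ {f x} rest≋0) (ℙ.zeroʳ (f x))))
... | inj₂ (m , e) | inj₂ (k , e′) = trans (cong (m ℕ.+_) (degree-prodₚ f xs e′)) (degree-unique (degree-* e e′) d)

X : Poly
X = 0ℤ ∷ oneₚ

const : ℤ → Poly
const a = a ∷ []

X*p≋0∷p : ∀ p → X *ₚ p ≋ 0ℤ ∷ p
X*p≋0∷p p = mk≋ λ
  { zero    → coeff-*-zero 0ℤ oneₚ p
  ; (suc k) → trans (coeff-*-suc 0ℤ oneₚ p k) (trans (ℤP.+-identityˡ _) (coeff-*-identityˡ p k)) }

X*xpow : ∀ m → xpow (suc m) ≋ X *ₚ xpow m
X*xpow m = ℙ.sym (X*p≋0∷p (xpow m))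

const* : ∀ a p k → coeff (const a *ₚ p) k ≡ a ℤ.* coeff p k
const* a p zero    = coeff-*-zero a [] p
const* a p (suc k) = trans (coeff-*-suc a [] p k) (ℤP.+-identityʳ _)

const-* : ∀ a b → const (a ℤ.* b) ≋ const a *ₚ const b
const-* a b = mk≋ λ { zero → sym (coeff-*-zero a [] (const b)) ; (suc k) → sym (trans (const* a (const b) (suc k)) (ℤP.*-zeroʳ a)) }

const-+ : ∀ a b → const (a ℤ.+ b) ≋ const a +ₚ const b
const-+ a b = mk≋ λ { zero → refl ; (suc k) → refl }

xpow-+ : ∀ m n → xpow (m ℕ.+ n) ≋ xpow m *ₚ xpow n
xpow-+ zero    n = ℙ.sym (ℙ.*-identityˡ _)
xpow-+ (suc m) n = begin
  xpow (suc (m ℕ.+ n))       ≈⟨ X*xpow (m ℕ.+ n) ⟩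
  X *ₚ xpow (m ℕ.+ n)        ≈⟨ ℙ.*-congˡ {X} (xpow-+ m n) ⟩
  X *ₚ (xpow m *ₚ xpow n)    ≈⟨ ℙ.*-assoc X (xpow m) (xpow n) ⟨
  X *ₚ xpow m *ₚ xpow n      ≈⟨ ℙ.*-congʳ {xpow n} (X*xpow m) ⟨
  xpow (suc m) *ₚ xpow n     ∎
  where open ≋-Reasoning

degree-xpow-1 : ∀ n → 1 ℕ.≤ n → HasDegree (xpow n +ₚ negₚ oneₚ) n
degree-xpow-1 (suc n) _ = degree-resp-≋ tail (mkDegree (subst (_≢ 0ℤ) (sym (top n)) (λ ())) (above n))
  where
  tail : (ℤ.- 1ℤ) ∷ xpow n ≋ xpow (suc n) +ₚ negₚ oneₚ
  tail = mk≋ λ { zero → refl ; (suc k) → sym (trans (coeff-+ (xpow n) [] k) (ℤP.+-identityʳ _)) }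
  top : ∀ n → coeff (xpow n) n ≡ 1ℤ
  top zero    = refl
  top (suc n) = top n
  above′ : ∀ n k → n ℕ.< k → coeff (xpow n) k ≡ 0ℤ
  above′ zero    (suc k) _         = refl
  above′ (suc n) (suc k) (s≤s n<k) = above′ n k n<k
  above : ∀ n k → suc n ℕ.< k → coeff ((ℤ.- 1ℤ) ∷ xpow n) k ≡ 0ℤ
  above n (suc k) (s≤s n<k) = above′ n k n<k

-- The product rule for a + X p: its derivative is p + X p′.
∂ : Poly → Poly
∂ []      = []
∂ (a ∷ p) = p +ₚ (0ℤ ∷ ∂ p)

coeff-∂ : ∀ p k → coeff (∂ p) k ≡ + suc k ℤ.* coeff p (suc k)
coeff-∂ []      k       = sym (ℤP.*-zeroʳ (+ suc k))
coeff-∂ (a ∷ p) zero    = trans (coeff-+ p _ 0) (trans (ℤP.+-identityʳ _) (sym (ℤP.*-identityˡ _)))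
coeff-∂ (a ∷ p) (suc k) = begin
  coeff (p +ₚ (0ℤ ∷ ∂ p)) (suc k)              ≡⟨ coeff-+ p _ (suc k) ⟩
  coeff p (suc k) ℤ.+ coeff (∂ p) k            ≡⟨ cong (ℤ._+_ (coeff p (suc k))) (coeff-∂ p k) ⟩
  coeff p (suc k) ℤ.+ + suc k ℤ.* coeff p (suc k) ≡⟨ ℤP.suc-* (+ suc k) _ ⟨
  + suc (suc k) ℤ.* coeff p (suc k)            ∎
  where open ≡-Reasoning

∂-cong : ∀ {p q} → p ≋ q → ∂ p ≋ ∂ q
∂-cong {p} {q} e = mk≋ λ k →
  trans (coeff-∂ p k) (trans (cong (+ suc k ℤ.*_) (at e (suc k))) (sym (coeff-∂ q k)))

∂-+ : ∀ p q → ∂ (p +ₚ q) ≋ ∂ p +ₚ ∂ q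
∂-+ p q = mk≋ λ k → begin
  coeff (∂ (p +ₚ q)) k                                               ≡⟨ coeff-∂ (p +ₚ q) k ⟩
  + suc k ℤ.* coeff (p +ₚ q) (suc k)                                 ≡⟨ cong (+ suc k ℤ.*_) (coeff-+ p q (suc k)) ⟩
  + suc k ℤ.* (coeff p (suc k) ℤ.+ coeff q (suc k))                  ≡⟨ ℤP.*-distribˡ-+ (+ suc k) (coeff p (suc k)) _ ⟩
  + suc k ℤ.* coeff p (suc k) ℤ.+ + suc k ℤ.* coeff q (suc k)        ≡⟨ cong₂ ℤ._+_ (coeff-∂ p k) (coeff-∂ q k) ⟨
  coeff (∂ p) k ℤ.+ coeff (∂ q) k                                    ≡⟨ coeff-+ (∂ p) (∂ q) k ⟨
  coeff (∂ p +ₚ ∂ q) k                                               ∎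
  where open ≡-Reasoning

∂-const* : ∀ a p → ∂ (const a *ₚ p) ≋ const a *ₚ ∂ p
∂-const* a p = mk≋ λ k → begin
  coeff (∂ (const a *ₚ p)) k                 ≡⟨ coeff-∂ (const a *ₚ p) k ⟩
  + suc k ℤ.* coeff (const a *ₚ p) (suc k)   ≡⟨ cong (+ suc k ℤ.*_) (const* a p (suc k)) ⟩
  + suc k ℤ.* (a ℤ.* coeff p (suc k))        ≡⟨ ℤP.*-assoc (+ suc k) a _ ⟨
  + suc k ℤ.* a ℤ.* coeff p (suc k)          ≡⟨ cong (ℤ._* coeff p (suc k)) (ℤP.*-comm (+ suc k) a) ⟩
  a ℤ.* + suc k ℤ.* coeff p (suc k)          ≡⟨ ℤP.*-assoc a _ _ ⟩
  a ℤ.* (+ suc k ℤ.* coeff p (suc k))        ≡⟨ cong (a ℤ.*_) (coeff-∂ p k) ⟨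
  a ℤ.* coeff (∂ p) k                        ≡⟨ const* a (∂ p) k ⟨
  coeff (const a *ₚ ∂ p) k                   ∎
  where open ≡-Reasoning

∷≋ : ∀ a p → a ∷ p ≋ const a +ₚ X *ₚ p
∷≋ a p = ℙ.trans (mk≋ λ { zero → sym (ℤP.+-identityʳ a) ; (suc k) → refl }) (ℙ.+-congˡ {const a} (ℙ.sym (X*p≋0∷p p)))

∂-∷ : ∀ a p → ∂ (a ∷ p) ≋ p +ₚ X *ₚ ∂ p
∂-∷ a p = ℙ.+-congˡ {p} (ℙ.sym (X*p≋0∷p (∂ p)))

∂-X* : ∀ p → ∂ (X *ₚ p) ≋ p +ₚ X *ₚ ∂ p
∂-X* p = ℙ.trans (∂-cong (X*p≋0∷p p)) (∂-∷ 0ℤ p)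

∂-* : ∀ p q → ∂ (p *ₚ q) ≋ ∂ p *ₚ q +ₚ p *ₚ ∂ q
∂-* []      q = ℙ.refl
∂-* (a ∷ p) q = begin
  ∂ ((a ∷ p) *ₚ q)                                    ≈⟨ ∂-cong (ℙ.*-congʳ {q} (∷≋ a p)) ⟩
  ∂ ((const a +ₚ X *ₚ p) *ₚ q)                        ≈⟨ ∂-cong (expand (const a) X p q) ⟩
  ∂ (const a *ₚ q +ₚ X *ₚ (p *ₚ q))                   ≈⟨ ∂-+ (const a *ₚ q) _ ⟩
  ∂ (const a *ₚ q) +ₚ ∂ (X *ₚ (p *ₚ q))               ≈⟨ ℙ.+-cong (∂-const* a q) (∂-X* (p *ₚ q)) ⟩
  const a *ₚ ∂ q +ₚ (p *ₚ q +ₚ X *ₚ ∂ (p *ₚ q))       ≈⟨ ℙ.+-congˡ {const a *ₚ ∂ q} (ℙ.+-congˡ {p *ₚ q} (ℙ.*-congˡ {X} (∂-* p q))) ⟩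
  const a *ₚ ∂ q +ₚ (p *ₚ q +ₚ X *ₚ (∂ p *ₚ q +ₚ p *ₚ ∂ q)) ≈⟨ collect (const a) X p q (∂ p) (∂ q) ⟩
  (p +ₚ X *ₚ ∂ p) *ₚ q +ₚ (const a +ₚ X *ₚ p) *ₚ ∂ q  ≈⟨ ℙ.+-cong (ℙ.*-congʳ (∂-∷ a p)) (ℙ.*-congʳ (∷≋ a p)) ⟨
  ∂ (a ∷ p) *ₚ q +ₚ (a ∷ p) *ₚ ∂ q                    ∎
  where
  open ≋-Reasoning
  expand : ∀ c x p q → (c +ₚ x *ₚ p) *ₚ q ≋ c *ₚ q +ₚ x *ₚ (p *ₚ q)
  expand = RS.solve-∀ poly-ring
  collect : ∀ c x p q p′ q′ → c *ₚ q′ +ₚ (p *ₚ q +ₚ x *ₚ (p′ *ₚ q +ₚ p *ₚ q′)) ≋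
    (p +ₚ x *ₚ p′) *ₚ q +ₚ (c +ₚ x *ₚ p) *ₚ q′
  collect = RS.solve-∀ poly-ring

-- The Euler operator X d/dX has the powers of X as eigenvectors; unlike d/dX itself it involves no
-- truncated exponent n - 1.
X*∂-xpow : ∀ n → X *ₚ ∂ (xpow n) ≋ const (+ n) *ₚ xpow n
X*∂-xpow zero    = ℙ.trans (X*p≋0∷p (∂ (xpow 0))) (mk≋ λ { zero → refl ; (suc zero) → refl ; (suc (suc k)) → refl })
X*∂-xpow (suc n) = begin
  X *ₚ ∂ (xpow (suc n))                            ≈⟨ ℙ.*-congˡ {X} (∂-∷ 0ℤ (xpow n)) ⟩
  X *ₚ (xpow n +ₚ X *ₚ ∂ (xpow n))                 ≈⟨ ℙ.*-congˡ {X} (ℙ.+-congˡ {xpow n} (X*∂-xpow n)) ⟩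
  X *ₚ (xpow n +ₚ const (+ n) *ₚ xpow n)           ≈⟨ collect X (xpow n) (const (+ n)) ⟩
  (oneₚ +ₚ const (+ n)) *ₚ (X *ₚ xpow n)           ≈⟨ ℙ.*-cong (const-+ 1ℤ (+ n)) (X*xpow n) ⟨
  const (+ suc n) *ₚ xpow (suc n)                  ∎
  where
  open ≋-Reasoning
  collect : ∀ x y c → x *ₚ (y +ₚ c *ₚ y) ≋ (oneₚ +ₚ c) *ₚ (x *ₚ y)
  collect = RS.solve-∀ poly-ring

-- Regular elements modulo φ

xpow-1 : ℕ → Poly
xpow-1 n = xpow n +ₚ negₚ oneₚ

infix 4 _∣≋_

record _∣≋_ (p q : Poly) : Set where
  constructor mk∣
  field
    quotient : Poly
    equality : p *ₚ quotient ≋ q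

∣≋-resp : ∀ {p q r} → q ≋ r → p ∣≋ q → p ∣≋ r
∣≋-resp e (mk∣ f h) = mk∣ f (ℙ.trans h e)

∣≋-*ˡ : ∀ {p q} r → p ∣≋ q → p ∣≋ r *ₚ q
∣≋-*ˡ {p} {q} r (mk∣ f h) = mk∣ (r *ₚ f) (begin
  p *ₚ (r *ₚ f)  ≈⟨ swap p r f ⟩
  r *ₚ (p *ₚ f)  ≈⟨ ℙ.*-congˡ {r} h ⟩
  r *ₚ q         ∎)
  where
  open ≋-Reasoning
  swap : ∀ x y z → x *ₚ (y *ₚ z) ≋ y *ₚ (x *ₚ z)
  swap = RS.solve-∀ poly-ring

∣≋-+ : ∀ {p q r} → p ∣≋ q → p ∣≋ r → p ∣≋ q +ₚ r
∣≋-+ {p} (mk∣ f h) (mk∣ g i) = mk∣ (f +ₚ g) (ℙ.trans (ℙ.distribˡ p f g) (ℙ.+-cong h i))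

∣≋-neg : ∀ {p q} → p ∣≋ q → p ∣≋ negₚ q
∣≋-neg {p} {q} (mk∣ f h) = mk∣ (negₚ f) (ℙ.trans (out p f) (ℙ.-‿cong h))
  where
  out : ∀ x y → x *ₚ negₚ y ≋ negₚ (x *ₚ y)
  out = RS.solve-∀ poly-ring

module _ (φ : Poly) where

  -- p is a non-zero-divisor modulo φ over ℚ; the integer N clears denominators.
  Regular : Poly → Set
  Regular p = ∀ x → φ ∣≋ p *ₚ x → ∃ λ N → N ≢ 0ℤ × φ ∣≋ const N *ₚ x

module _ {φ : Poly} where

  regular-resp : ∀ {p q} → p ≋ q → Regular φ p → Regular φ q
  regular-resp e reg x h = reg x (∣≋-resp (ℙ.*-congʳ {x} (ℙ.sym e)) h)

  -- The second hypothesis is applied to M x, where M is the denominator produced by the first; the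
  -- denominators multiply.
  regular-* : ∀ {p q} → Regular φ p → Regular φ q → Regular φ (p *ₚ q)
  regular-* {p} {q} regp regq x h with regp (q *ₚ x) (∣≋-resp (ℙ.*-assoc p q x) h)
  ... | M , M≢0 , h′ with regq (const M *ₚ x) (∣≋-resp (swap (const M) q x) h′)
    where
    swap : ∀ c y z → c *ₚ (y *ₚ z) ≋ y *ₚ (c *ₚ z)
    swap = RS.solve-∀ poly-ring
  ... | N , N≢0 , h″ = N ℤ.* M , (λ z → [ N≢0 , M≢0 ]′ (ℤP.i*j≡0⇒i≡0∨j≡0 N z)) ,
    ∣≋-resp (ℙ.trans (ℙ.sym (ℙ.*-assoc (const N) (const M) x)) (ℙ.*-congʳ {x} (ℙ.sym (const-* N M)))) h″

  regular-one : Regular φ oneₚ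
  regular-one x h = 1ℤ , (λ ()) , h

  regular-factor : ∀ {p} q → Regular φ (p *ₚ q) → Regular φ p
  regular-factor {p} q reg x h = reg x (∣≋-resp (swap q p x) (∣≋-*ˡ q h))
    where
    swap : ∀ a b c → a *ₚ (b *ₚ c) ≋ b *ₚ a *ₚ c
    swap = RS.solve-∀ poly-ring

  regular-neg : ∀ {p} → Regular φ p → Regular φ (negₚ p)
  regular-neg {p} reg x h = reg x (∣≋-resp (out p x) (∣≋-neg h))
    where
    out : ∀ a b → negₚ (negₚ a *ₚ b) ≋ a *ₚ b
    out = RS.solve-∀ poly-ring

  regular-prodₚ : ∀ {A : Set} (f : A → Poly) xs → (∀ {x} → x ∈ xs → Regular φ (f x)) →
    Regular φ (prodₚ (map f xs))
  regular-prodₚ f []       reg = regular-one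
  regular-prodₚ f (x ∷ xs) reg = regular-* {f x} (reg (here refl)) (regular-prodₚ f xs (reg ∘ there))

  -- q^e - 1 is coprime to its derivative: X·P′ - e·P = e for P = q^e - 1.
  regular-cofactor : ∀ {u} e → 1 ℕ.≤ e → φ *ₚ u ≋ xpow-1 e → Regular φ u
  regular-cofactor {u} e 1≤e φu≋P x (mk∣ f φf≋ux) = + e , (λ z → ℕP.<⇒≢ 1≤e (sym (ℤP.+-injective z))) ,
    -- Multiply X·P′ - e·P = e by x, insert P = φ u, and replace u x by φ f in the term X φ′ u x.
    -- Every term on the left then contains φ, and this is the quotient.
    mk∣ (X *ₚ ∂ φ *ₚ f +ₚ X *ₚ ∂ u *ₚ x +ₚ negₚ (const (+ e) *ₚ u *ₚ x)) (begin
      φ *ₚ (X *ₚ ∂ φ *ₚ f +ₚ X *ₚ ∂ u *ₚ x +ₚ negₚ (c *ₚ u *ₚ x)) ≈⟨ expand φ X (∂ φ) f (∂ u) x c u ⟩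
      X *ₚ ∂ φ *ₚ (φ *ₚ f) +ₚ φ *ₚ (X *ₚ ∂ u *ₚ x +ₚ negₚ (c *ₚ u *ₚ x))
        ≈⟨ ℙ.+-congʳ {φ *ₚ (X *ₚ ∂ u *ₚ x +ₚ negₚ (c *ₚ u *ₚ x))} (ℙ.*-congˡ {X *ₚ ∂ φ} φf≋ux) ⟩
      X *ₚ ∂ φ *ₚ (u *ₚ x) +ₚ φ *ₚ (X *ₚ ∂ u *ₚ x +ₚ negₚ (c *ₚ u *ₚ x)) ≈⟨ collect φ X (∂ φ) (∂ u) x c u ⟩
      (X *ₚ (∂ φ *ₚ u +ₚ φ *ₚ ∂ u) +ₚ negₚ (c *ₚ (φ *ₚ u))) *ₚ x
        ≈⟨ ℙ.*-congʳ {x} (ℙ.+-cong (ℙ.*-congˡ {X} derivative) (ℙ.-‿cong (ℙ.*-congˡ {c} φu≋P))) ⟩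
      (X *ₚ ∂ (xpow e) +ₚ negₚ (c *ₚ xpow-1 e)) *ₚ x
        ≈⟨ ℙ.*-congʳ {x} (ℙ.+-congʳ {negₚ (c *ₚ xpow-1 e)} (X*∂-xpow e)) ⟩
      (c *ₚ xpow e +ₚ negₚ (c *ₚ xpow-1 e)) *ₚ x ≈⟨ cancel c (xpow e) x ⟩
      c *ₚ x ∎)
    where
    open ≋-Reasoning
    c : Poly
    c = const (+ e)
    ∂-const : ∂ (negₚ oneₚ) ≋ []
    ∂-const = mk≋ λ { zero → refl ; (suc k) → refl }
    derivative : ∂ φ *ₚ u +ₚ φ *ₚ ∂ u ≋ ∂ (xpow e)
    derivative = begin
      ∂ φ *ₚ u +ₚ φ *ₚ ∂ u           ≈⟨ ∂-* φ u ⟨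
      ∂ (φ *ₚ u)                     ≈⟨ ∂-cong φu≋P ⟩
      ∂ (xpow-1 e)                    ≈⟨ ∂-+ (xpow e) (negₚ oneₚ) ⟩
      ∂ (xpow e) +ₚ ∂ (negₚ oneₚ)    ≈⟨ ℙ.+-congˡ {∂ (xpow e)} ∂-const ⟩
      ∂ (xpow e) +ₚ []               ≈⟨ ℙ.+-identityʳ (∂ (xpow e)) ⟩
      ∂ (xpow e)                     ∎
    expand : ∀ φ X φ′ f u′ x c u → φ *ₚ (X *ₚ φ′ *ₚ f +ₚ X *ₚ u′ *ₚ x +ₚ negₚ (c *ₚ u *ₚ x)) ≋
      X *ₚ φ′ *ₚ (φ *ₚ f) +ₚ φ *ₚ (X *ₚ u′ *ₚ x +ₚ negₚ (c *ₚ u *ₚ x))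
    expand = RS.solve-∀ poly-ring
    collect : ∀ φ X φ′ u′ x c u → X *ₚ φ′ *ₚ (u *ₚ x) +ₚ φ *ₚ (X *ₚ u′ *ₚ x +ₚ negₚ (c *ₚ u *ₚ x)) ≋
      (X *ₚ (φ′ *ₚ u +ₚ φ *ₚ u′) +ₚ negₚ (c *ₚ (φ *ₚ u))) *ₚ x
    collect = RS.solve-∀ poly-ring
    cancel : ∀ c y x → (c *ₚ y +ₚ negₚ (c *ₚ (y +ₚ negₚ oneₚ))) *ₚ x ≋ c *ₚ x
    cancel = RS.solve-∀ poly-ring

  -- X is invertible modulo φ, with inverse X^(b-1), because φ divides X^b - 1. This takes care of
  -- the denominators q^(m+1) of the factors with negative exponent.
  regular-xpow : ∀ b → 1 ℕ.≤ b → φ ∣≋ xpow-1 b → ∀ m → Regular φ (xpow m)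
  regular-xpow (suc b) _ φ∣P zero    = regular-one
  regular-xpow (suc b) h φ∣P (suc m) =
    regular-resp (ℙ.sym (X*xpow m)) (regular-* {X} {xpow m} regular-X (regular-xpow (suc b) h φ∣P m))
    where
    split : ∀ X y x → y *ₚ (X *ₚ x) +ₚ negₚ (x *ₚ (X *ₚ y +ₚ negₚ oneₚ)) ≋ oneₚ *ₚ x
    split = RS.solve-∀ poly-ring
    regular-X : Regular φ X
    regular-X x φ∣Xx = 1ℤ , (λ ()) , ∣≋-resp (split X (xpow b) x)
      (∣≋-+ (∣≋-*ˡ (xpow b) φ∣Xx) (∣≋-neg (∣≋-*ˡ x (∣≋-resp (ℙ.+-congʳ {negₚ oneₚ} (X*xpow b)) φ∣P))))

  -- The exponents a such that q^a acts as the identity on x modulo φ.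
  Period : Poly → ℕ → Set
  Period x a = φ ∣≋ xpow-1 a *ₚ x

  period-+ : ∀ {x} a c → Period x a → Period x c → Period x (a ℕ.+ c)
  period-+ {x} a c ha hc = ∣≋-resp
    (ℙ.trans (split (xpow a) (xpow c) x) (ℙ.*-congʳ {x} (ℙ.+-congʳ {negₚ oneₚ} (ℙ.sym (xpow-+ a c)))))
    (∣≋-+ ha (∣≋-*ˡ (xpow a) hc))
    where
    split : ∀ y z x → (y +ₚ negₚ oneₚ) *ₚ x +ₚ y *ₚ ((z +ₚ negₚ oneₚ) *ₚ x) ≋ (y *ₚ z +ₚ negₚ oneₚ) *ₚ x
    split = RS.solve-∀ poly-ring

  period-∸ : ∀ {x} a c → Period x (a ℕ.+ c) → Period x c → Period x a
  period-∸ {x} a c hac hc = ∣≋-resp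
    (ℙ.trans (ℙ.+-congʳ {negₚ (xpow a *ₚ (xpow-1 c *ₚ x))} (ℙ.*-congʳ {x} (ℙ.+-congʳ {negₚ oneₚ} (xpow-+ a c))))
      (split (xpow a) (xpow c) x))
    (∣≋-+ hac (∣≋-neg (∣≋-*ˡ (xpow a) hc)))
    where
    split : ∀ y z x → (y *ₚ z +ₚ negₚ oneₚ) *ₚ x +ₚ negₚ (y *ₚ ((z +ₚ negₚ oneₚ) *ₚ x)) ≋ (y +ₚ negₚ oneₚ) *ₚ x
    split = RS.solve-∀ poly-ring

  period-* : ∀ {x} k a → Period x a → Period x (k ℕ.* a)
  period-* {x} zero    a ha = mk∣ [] (ℙ.trans (ℙ.zeroʳ φ) (ℙ.sym (vanish x)))
    where
    vanish : ∀ x → (oneₚ +ₚ negₚ oneₚ) *ₚ x ≋ []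
    vanish x = ℙ.trans (ℙ.*-congʳ {x} (ℙ.-‿inverseʳ oneₚ)) (ℙ.zeroˡ x)
  period-* (suc k) a ha = period-+ a (k ℕ.* a) ha (period-* k a ha)

  -- Over ℕ, Bézout's identity reads g + l n = k m or g + k m = l n, so the gcd is reached from the
  -- periods m and n by taking multiples and one subtraction.
  period-gcd : ∀ {x} m n → Period x m → Period x n → Period x (gcd m n)
  period-gcd {x} m n hm hn with G.Bézout.identity (G.gcd-GCD m n)
  ... | G.Bézout.+- k l eq = period-∸ (gcd m n) (l ℕ.* n) (subst (Period x) (sym eq) (period-* k m hm)) (period-* l n hn)
  ... | G.Bézout.-+ k l eq = period-∸ (gcd m n) (k ℕ.* m) (subst (Period x) (sym eq) (period-* l n hn)) (period-* k m hm)

-- Divisor sums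

∈-divisorsℕ⁺ : ∀ {d n} → 1 ≤ n → d ∣ n → d ∈ divisorsℕ n
∈-divisorsℕ⁺ {zero}  {suc n} _ d∣n = ⊥-elim (ℕP.0≢1+n (sym (ℕD.0∣⇒≡0 d∣n)))
∈-divisorsℕ⁺ {suc d} {suc n} _ d∣n = ∈-filter⁺ (_∣? suc n) (∈-applyUpTo⁺ suc (ℕD.∣⇒≤ d∣n)) d∣n

∈-divisorsℕ⁻ : ∀ {d n} → d ∈ divisorsℕ n → 1 ≤ d × d ∣ n
∈-divisorsℕ⁻ {d} {n} d∈ with ∈-filter⁻ (_∣? n) {xs = applyUpTo suc n} d∈
... | d∈′ , d∣n with ∈-applyUpTo⁻ suc d∈′
...   | _ , _ , refl = s≤s z≤n , d∣n

divisorsℕ-unique : ∀ n → Unique (divisorsℕ n)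
divisorsℕ-unique n = Unique.filter⁺ (_∣? n) (Unique.applyUpTo⁺₁ suc n (λ i<j _ → ℕP.<⇒≢ (s≤s i<j)))

prime∤⇒coprime : ∀ {p t} → Prime p → ¬ p ∣ t → ∀ j → Coprime t (p ^ j)
prime∤⇒coprime pr p∤t zero    (_ , d∣1) = ℕD.∣1⇒≡1 d∣1
prime∤⇒coprime {p} {t} pr p∤t (suc j) {d} (d∣t , d∣) =
  prime∤⇒coprime pr p∤t j (d∣t , coprime-divisor {d} {p} coprime d∣)
  where
  coprime : Coprime d p
  coprime (e∣d , e∣p) with prime⇒irreducible pr e∣p
  ... | inj₁ e≡1  = e≡1
  ... | inj₂ refl = ⊥-elim (p∤t (ℕD.∣-trans e∣d d∣t))

-- Sort the divisors i by the complementary divisor t, where t i = p^(j+1) d. If p ∣ t, then i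
-- divides p^j d; otherwise t is coprime to p^(j+1), hence t ∣ d and i = p^(j+1) (d/t). All lists
-- are free of duplicates, so equality as sets already gives a permutation.
divisorsℕ-split : ∀ {p} → Prime p → ∀ j d → 1 ≤ d → ¬ p ∣ d →
  divisorsℕ (p ^ suc j * d) ↭ divisorsℕ (p ^ j * d) ++ map (p ^ suc j *_) (divisorsℕ d)
divisorsℕ-split {p} pr j d 1≤d p∤d = ∼bag⇒↭ (unique∧set⇒bag (divisorsℕ-unique (p ^ suc j * d))
  (Unique.++⁺ (divisorsℕ-unique (p ^ j * d))
    (Unique.map⁺ (ℕP.*-cancelˡ-≡ _ _ (p ^ suc j) {{ℕP.m^n≢0 p (suc j)}}) (divisorsℕ-unique d))
    disjoint)
  (mk⇔ to from))
  where
  instance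
    p≢0 : NonZero p
    p≢0 = prime⇒nonZero pr
  1≤p^*d : ∀ j → 1 ≤ p ^ j * d
  1≤p^*d j = ℕP.*-mono-≤ (>-nonZero⁻¹ (p ^ j) {{ℕP.m^n≢0 p j}}) 1≤d
  disjoint : ∀ {i} → ¬ (i ∈ divisorsℕ (p ^ j * d) × i ∈ map (p ^ suc j *_) (divisorsℕ d))
  disjoint (i∈ , i∈′) with ∈-map⁻ (p ^ suc j *_) i∈′
  ... | e , e∈ , refl = p∤d (ℕD.∣-trans (ℕD.m∣m*n e) (ℕD.*-cancelˡ-∣ (p ^ j) {{ℕP.m^n≢0 p j}}
          (subst (_∣ p ^ j * d) (reorder p (p ^ j) e) (proj₂ (∈-divisorsℕ⁻ {n = p ^ j * d} i∈)))))
    where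
    reorder : ∀ p P e → p * P * e ≡ P * (p * e)
    reorder = ℕSolver.solve-∀
  to : ∀ {i} → i ∈ divisorsℕ (p ^ suc j * d) → i ∈ divisorsℕ (p ^ j * d) ++ map (p ^ suc j *_) (divisorsℕ d)
  to {i} i∈ with ∈-divisorsℕ⁻ {n = p ^ suc j * d} i∈
  ... | 1≤i , divides t eq with p ∣? t
  ...   | yes (divides t′ refl) = ∈-++⁺ˡ (∈-divisorsℕ⁺ (1≤p^*d j) (divides t′ (ℕP.*-cancelˡ-≡ _ _ p (begin
          p * (p ^ j * d)  ≡⟨ ℕP.*-assoc p (p ^ j) d ⟨
          p ^ suc j * d    ≡⟨ eq ⟩
          t′ * p * i       ≡⟨ reorder t′ p i ⟩
          p * (t′ * i)     ∎))))
    where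
    open ≡-Reasoning
    reorder : ∀ t p i → t * p * i ≡ p * (t * i)
    reorder = ℕSolver.solve-∀
  ...   | no p∤t with coprime-divisor {t} {p ^ suc j} {d} (prime∤⇒coprime pr p∤t (suc j)) (divides i (trans eq (ℕP.*-comm t i)))
  ...     | divides e refl = ∈-++⁺ʳ (divisorsℕ (p ^ j * d))
            (subst (_∈ map (p ^ suc j *_) (divisorsℕ d)) (sym i≡) (∈-map⁺ _ (∈-divisorsℕ⁺ 1≤d (ℕD.m∣m*n t))))
    where
    open ≡-Reasoning
    instance
      t≢0 : NonZero t
      t≢0 = ≢-nonZero λ { refl → ℕP.<⇒≢ 1≤d (sym (ℕP.*-zeroʳ e)) }
    i≡ : i ≡ p ^ suc j * e
    i≡ = ℕP.*-cancelˡ-≡ _ _ t (begin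
      t * i                ≡⟨ eq ⟨
      p ^ suc j * (e * t)  ≡⟨ ℕP.*-assoc (p ^ suc j) e t ⟨
      p ^ suc j * e * t    ≡⟨ ℕP.*-comm _ t ⟩
      t * (p ^ suc j * e)  ∎)
  from : ∀ {i} → i ∈ divisorsℕ (p ^ j * d) ++ map (p ^ suc j *_) (divisorsℕ d) → i ∈ divisorsℕ (p ^ suc j * d)
  from i∈ with ∈-++⁻ (divisorsℕ (p ^ j * d)) i∈
  ... | inj₁ i∈′ = ∈-divisorsℕ⁺ (1≤p^*d (suc j))
        (ℕD.∣-trans (proj₂ (∈-divisorsℕ⁻ {n = p ^ j * d} i∈′)) (subst (p ^ j * d ∣_) (sym (ℕP.*-assoc p (p ^ j) d)) (ℕD.n∣m*n p)))
  ... | inj₂ i∈′ with ∈-map⁻ (p ^ suc j *_) i∈′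
  ...   | e , e∈ , refl = ∈-divisorsℕ⁺ (1≤p^*d (suc j)) (ℕD.*-monoʳ-∣ (p ^ suc j) (proj₂ (∈-divisorsℕ⁻ {n = d} e∈)))

-- The prime is returned in the form `2+ k` so that p - 1 = `suc k`, a factor of the new constant in
-- `divisorSum-linear⇒positive`, is visibly positive.
prime-divisor : ∀ n → 2 ≤ n → ∃ λ k → Prime (2+ k) × 2+ k ∣ n
prime-divisor n 2≤n with factorise n {{>-nonZero (ℕP.<⇒≤ 2≤n)}}
... | record { factors = [] ; isFactorisation = refl } = ⊥-elim (ℕP.<⇒≱ 2≤n ℕP.≤-refl)
... | record { factors = p ∷ ps ; isFactorisation = eq ; factorsPrime = pr ∷ _ }
  with p | nonTrivial⇒n>1 p {{prime⇒nonTrivial pr}} | pr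
...   | 2+ k | _ | pr = k , pr , divides (product ps) (trans eq (ℕP.*-comm (2+ k) (product ps)))

power-part : ∀ {p} → Prime p → ∀ n → Acc _<_ n → 1 ≤ n → ∃₂ λ j m → n ≡ p ^ j * m × ¬ p ∣ m
power-part {p} pr n (acc rec) 1≤n with p ∣? n
... | no  p∤n = 0 , n , sym (ℕP.*-identityˡ n) , p∤n
... | yes (divides m refl) with power-part pr m (rec m<m*p) 1≤m
  where
  1≤m : 1 ≤ m
  1≤m = ℕP.n≢0⇒n>0 λ { refl → ℕP.<⇒≢ 1≤n refl }
  m<m*p : m < m * p
  m<m*p = ℕP.m<m*n m p {{>-nonZero 1≤m}} (nonTrivial⇒n>1 p {{prime⇒nonTrivial pr}})
...   | j , m′ , refl , p∤m′ = suc j , m′ , trans (ℕP.*-comm _ p) (sym (ℕP.*-assoc p (p ^ j) m′)) , p∤m′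

divisorSum : (ℕ → ℕ) → ℕ → ℕ
divisorSum f n = sum (map f (divisorsℕ n))

divisorSum-split : ∀ {p} → Prime p → ∀ f j d → 1 ≤ d → ¬ p ∣ d →
  divisorSum f (p ^ suc j * d) ≡ divisorSum f (p ^ j * d) + divisorSum (λ e → f (p ^ suc j * e)) d
divisorSum-split {p} pr f j d 1≤d p∤d = begin
  sum (map f (divisorsℕ (p ^ suc j * d)))                    ≡⟨ sum-↭ (Perm.map⁺ f (divisorsℕ-split pr j d 1≤d p∤d)) ⟩
  sum (map f (ds ++ map (p ^ suc j *_) es))                  ≡⟨ cong sum (map-++ f ds _) ⟩
  sum (map f ds ++ map f (map (p ^ suc j *_) es))            ≡⟨ sum-++ (map f ds) _ ⟩
  sum (map f ds) + sum (map f (map (p ^ suc j *_) es))       ≡⟨ cong (λ l → sum (map f ds) + sum l) (map-∘ es) ⟨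
  sum (map f ds) + sum (map (λ e → f (p ^ suc j * e)) es)    ∎
  where
  open ≡-Reasoning
  ds = divisorsℕ (p ^ j * d)
  es = divisorsℕ d

-- The constant c makes the induction go through: for n = p^(j+1) m with p ∤ m, the function
-- e ↦ f (p^(j+1) e) has divisor sums c p^j (p - 1) d on the divisors d of m.
divisorSum-linear⇒positive : ∀ n → Acc _<_ n → 1 ≤ n → ∀ f c → 1 ≤ c →
  (∀ d → d ∣ n → divisorSum f d ≡ c * d) → 1 ≤ f n
divisorSum-linear⇒positive 1 _ _ f c 1≤c h =
  subst (1 ≤_) (sym (trans (sym (ℕP.+-identityʳ (f 1))) (trans (h 1 ℕD.∣-refl) (ℕP.*-identityʳ c)))) 1≤c
divisorSum-linear⇒positive n@(suc (suc _)) (acc rec) 1≤n f c 1≤c h with prime-divisor n (s≤s (s≤s z≤n))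
... | k , pr , p∣n with power-part pr n (<-wellFounded n) 1≤n
...   | zero  , m , n≡ , p∤m = ⊥-elim (p∤m (subst (_ ∣_) (trans n≡ (ℕP.*-identityˡ m)) p∣n))
...   | suc j , m , n≡ , p∤m = subst (λ x → 1 ≤ f x) (sym n≡)
          (divisorSum-linear⇒positive m (rec m<n) 1≤m (λ e → f (q ^ suc j * e)) (c * (q ^ j * suc k))
            (ℕP.*-mono-≤ 1≤c (ℕP.*-mono-≤ (>-nonZero⁻¹ (q ^ j) {{ℕP.m^n≢0 q j}}) (s≤s z≤n))) linear)
  where
  q : ℕ
  q = 2+ k
  1≤m : 1 ≤ m
  1≤m = ℕP.n≢0⇒n>0 λ { refl → ℕP.<⇒≢ 1≤n (sym (trans n≡ (ℕP.*-zeroʳ (q ^ suc j)))) }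
  m<n : m < n
  m<n = subst (m <_) (sym (trans n≡ (ℕP.*-comm _ m)))
    (ℕP.m<m*n m (q ^ suc j) {{>-nonZero 1≤m}} (ℕP.≤-trans (s≤s (s≤s z≤n)) (ℕP.m≤m*n q (q ^ j) {{ℕP.m^n≢0 q j}})))
  arith : ∀ c Q k d → c * ((2 + k) * Q * d) ≡ c * (Q * d) + c * (Q * (1 + k)) * d
  arith = ℕSolver.solve-∀
  -- Both q^j d and q^(j+1) d divide n, and the divisors of the second that do not divide the first
  -- are the q^(j+1) e with e ∣ d. Cancelling the sum at q^j d leaves c (q^(j+1) - q^j) d.
  linear : ∀ d → d ∣ m → divisorSum (λ e → f (q ^ suc j * e)) d ≡ c * (q ^ j * suc k) * d
  linear d d∣m = ℕP.+-cancelˡ-≡ (c * (q ^ j * d)) _ _ (begin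
    c * (q ^ j * d) + divisorSum (λ e → f (q ^ suc j * e)) d
      ≡⟨ cong (_+ divisorSum (λ e → f (q ^ suc j * e)) d) (h (q ^ j * d)
          (ℕD.∣-trans (ℕD.*-monoʳ-∣ (q ^ j) d∣m) (subst (q ^ j * m ∣_) (sym (trans n≡ (ℕP.*-assoc q (q ^ j) m))) (ℕD.n∣m*n q)))) ⟨
    divisorSum f (q ^ j * d) + divisorSum (λ e → f (q ^ suc j * e)) d
      ≡⟨ divisorSum-split pr f j d (ℕP.n≢0⇒n>0 λ { refl → ℕP.<⇒≢ 1≤m (sym (ℕD.0∣⇒≡0 d∣m)) }) (λ q∣d → p∤m (ℕD.∣-trans q∣d d∣m)) ⟨
    divisorSum f (q ^ suc j * d)
      ≡⟨ h (q ^ suc j * d) (subst (q ^ suc j * d ∣_) (sym n≡) (ℕD.*-monoʳ-∣ (q ^ suc j) d∣m)) ⟩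
    c * (q ^ suc j * d)
      ≡⟨ arith c (q ^ j) k d ⟩
    c * (q ^ j * d) + c * (q ^ j * suc k) * d ∎)
    where open ≡-Reasoning

-- Cyclotomic valuations

-- `ys` is `xs` with one occurrence of `x` removed. The last component allows a second extraction:
-- `regular-Φ` takes out `Φ b` and then finds `Φ d` in what remains.
prodₚ-extract : ∀ {A : Set} (f : A → Poly) {x xs} → x ∈ xs → ∃ λ ys →
  f x *ₚ prodₚ (map f ys) ≋ prodₚ (map f xs) × (∀ {y} → y ∈ xs → y ≢ x → y ∈ ys)
prodₚ-extract f {x} {_ ∷ xs} (here refl) = xs , ℙ.refl , λ
  { (here y≡x) y≢x → ⊥-elim (y≢x y≡x) ; (there y∈) _ → y∈ }
prodₚ-extract f {x} {z ∷ xs} (there x∈) with prodₚ-extract f x∈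
... | ys , eq , keep = z ∷ ys , ℙ.trans (swap (f x) (f z) _) (ℙ.*-congˡ {f z} eq) , λ
  { (here y≡z) _ → here y≡z ; (there y∈) y≢x → there (keep y∈ y≢x) }
  where
  swap : ∀ a b c → a *ₚ (b *ₚ c) ≋ b *ₚ (a *ₚ c)
  swap = RS.solve-∀ poly-ring

-- A strengthening of `HasVal` for non-constant φ: the cofactor is regular modulo φ, not merely
-- indivisible by φ. In this form exponents add under products without φ being prime.
record ExactPower (φ p : Poly) (ν : ℕ) : Set where
  constructor exactPower
  field
    cofactor  : Poly
    splitting : powₚ φ ν *ₚ cofactor ≋ p
    regular   : Regular φ cofactor

powₚ-+ : ∀ φ m n → powₚ φ (m ℕ.+ n) ≋ powₚ φ m *ₚ powₚ φ n
powₚ-+ φ zero    n = ℙ.sym (ℙ.*-identityˡ _)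
powₚ-+ φ (suc m) n = ℙ.trans (ℙ.*-congˡ {φ} (powₚ-+ φ m n)) (ℙ.sym (ℙ.*-assoc φ (powₚ φ m) _))

exactPower-* : ∀ {φ p q m n} → ExactPower φ p m → ExactPower φ q n → ExactPower φ (p *ₚ q) (m ℕ.+ n)
exactPower-* {φ} {p} {q} {m} {n} (exactPower u pu ru) (exactPower w qw rw) = exactPower (u *ₚ w) (begin
  powₚ φ (m ℕ.+ n) *ₚ (u *ₚ w)          ≈⟨ ℙ.*-congʳ {u *ₚ w} (powₚ-+ φ m n) ⟩
  powₚ φ m *ₚ powₚ φ n *ₚ (u *ₚ w)      ≈⟨ interchange (powₚ φ m) (powₚ φ n) u w ⟩
  (powₚ φ m *ₚ u) *ₚ (powₚ φ n *ₚ w)    ≈⟨ ℙ.*-cong pu qw ⟩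
  p *ₚ q                                ∎) (regular-* {p = u} {q = w} ru rw)
  where
  open ≋-Reasoning
  interchange : ∀ a b c d → a *ₚ b *ₚ (c *ₚ d) ≋ (a *ₚ c) *ₚ (b *ₚ d)
  interchange = RS.solve-∀ poly-ring

regular⇒exactPower-0 : ∀ {φ p} → Regular φ p → ExactPower φ p 0
regular⇒exactPower-0 {φ} {p} reg = exactPower p (ℙ.*-identityˡ p) reg

exactPower-neg : ∀ {φ p q ν} → negₚ p ≋ q → ExactPower φ p ν → ExactPower φ q ν
exactPower-neg {φ} {ν = ν} e (exactPower u pu ru) =
  exactPower (negₚ u) (ℙ.trans (out (powₚ φ ν) u) (ℙ.trans (ℙ.-‿cong pu) e)) (regular-neg {p = u} ru)
  where
  out : ∀ a b → a *ₚ negₚ b ≋ negₚ (a *ₚ b)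
  out = RS.solve-∀ poly-ring

degree-const : ∀ {N} → N ≢ 0ℤ → HasDegree (const N) 0
degree-const N≢0 = mkDegree N≢0 λ { (suc k) _ → refl }

module _ {φ : Poly} {n : ℕ} (deg : HasDegree φ (suc n)) where

  nonconstant⇒∤const : ∀ {N} → N ≢ 0ℤ → ¬ φ ∣≋ const N
  nonconstant⇒∤const N≢0 (mk∣ e φe≋N) with zero-or-degree e
  ... | inj₁ e≋0      = N≢0 (at (ℙ.trans (ℙ.sym φe≋N) (ℙ.trans (ℙ.*-congˡ {φ} e≋0) (ℙ.zeroʳ φ))) 0)
  ... | inj₂ (k , de) with degree-unique (degree-* deg de) (degree-resp-≋ (ℙ.sym φe≋N) (degree-const N≢0))
  ...   | ()

  powₚ-cancelˡ : ∀ ν {p q} → powₚ φ ν *ₚ p ≋ powₚ φ ν *ₚ q → p ≋ q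
  powₚ-cancelˡ zero    {p} {q} e = ℙ.trans (ℙ.sym (ℙ.*-identityˡ p)) (ℙ.trans e (ℙ.*-identityˡ q))
  powₚ-cancelˡ (suc ν) {p} {q} e = powₚ-cancelˡ ν (*ₚ-cancelˡ (degree⇒≉0 deg)
    (ℙ.trans (ℙ.sym (ℙ.*-assoc φ (powₚ φ ν) p)) (ℙ.trans e (ℙ.*-assoc φ (powₚ φ ν) q))))

  -- If φ^(ν+1) divided p = φ^ν u, cancelling φ^ν would give φ ∣ u·1. Regularity of u, tested on x =
  -- 1, would then make φ divide a non-zero integer, against its positive degree.
  exactPower⇒HasVal : ∀ {p ν} → ExactPower φ p ν → HasVal φ p ν
  exactPower⇒HasVal {p} {ν} (exactPower u pu ru) = (u , ≋⇒≈ₚ pu) , higher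
    where
    higher : ¬ powₚ φ (suc ν) ∣ₚ p
    higher (e , eq) = contradict (ru oneₚ (∣≋-resp (ℙ.sym (ℙ.*-identityʳ u)) (mk∣ e φe≋u)))
      where
      reorder : ∀ a b c → b *ₚ (a *ₚ c) ≋ a *ₚ b *ₚ c
      reorder = RS.solve-∀ poly-ring
      φe≋u : φ *ₚ e ≋ u
      φe≋u = powₚ-cancelˡ ν (ℙ.trans (reorder φ (powₚ φ ν) e) (ℙ.trans (≈ₚ⇒≋ eq) (ℙ.sym pu)))
      contradict : ¬ ∃ λ N → N ≢ 0ℤ × φ ∣≋ const N *ₚ oneₚ
      contradict (N , N≢0 , h) = nonconstant⇒∤const N≢0 (∣≋-resp (ℙ.*-identityʳ (const N)) h)

-- At e = 0 the value is 1, which is not a valuation of 1 - q^0 = 0. `PochDefinedNonzero` excludes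
-- that exponent on the polynomial side, while the count of multiples of b stays periodic without an
-- exception.
multiplicity : ℕ → ℤ → ℕ
multiplicity b e = if does (b ∣? ∣ e ∣) then 1 else 0

totalMultiplicity : ℕ → List ℤ → ℕ
totalMultiplicity b es = sum (map (multiplicity b) es)

module _ {Φ : ℕ → Poly} (cyclotomic : IsCyclotomicFamily Φ) where

  prodₚ-Φ : ∀ n → 1 ℕ.≤ n → prodₚ (map Φ (divisorsℕ n)) ≋ xpow-1 n
  prodₚ-Φ n 1≤n = ≈ₚ⇒≋ (cyclotomic n 1≤n)

  Φ-degree : ∀ b → 1 ℕ.≤ b → ∃ λ n → HasDegree (Φ b) (suc n)
  Φ-degree b 1≤b = positive-degree (Φ b) (divisorSum-linear⇒positive b (<-wellFounded b) 1≤b (degree ∘ Φ) 1 (s≤s z≤n) degree-sum)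
    where
    degree-sum : ∀ d → d ∣ b → divisorSum (degree ∘ Φ) d ≡ 1 ℕ.* d
    degree-sum d d∣b = trans (degree-prodₚ Φ (divisorsℕ d) (degree-resp-≋ (ℙ.sym (prodₚ-Φ d 1≤d)) (degree-xpow-1 d 1≤d)))
      (sym (ℕP.*-identityˡ d))
      where
      1≤d : 1 ℕ.≤ d
      1≤d = ℕP.n≢0⇒n>0 λ { refl → ℕP.<⇒≢ 1≤b (sym (ℕD.0∣⇒≡0 d∣b)) }

  module _ {b : ℕ} (1≤b : 1 ℕ.≤ b) where

    Φ∣xpow-1 : ∀ e → 1 ℕ.≤ e → b ∣ e → Φ b ∣≋ xpow-1 e
    Φ∣xpow-1 e 1≤e b∣e with prodₚ-extract Φ (∈-divisorsℕ⁺ 1≤e b∣e)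
    ... | ys , eq , _ = mk∣ (prodₚ (map Φ ys)) (ℙ.trans eq (prodₚ-Φ e 1≤e))

    regular-Φ : ∀ {d} → d ∣ b → d ≢ b → Regular (Φ b) (Φ d)
    regular-Φ {d} d∣b d≢b with prodₚ-extract Φ (∈-divisorsℕ⁺ 1≤b ℕD.∣-refl)
    ... | ys , eq , keep with prodₚ-extract Φ (keep (∈-divisorsℕ⁺ 1≤b d∣b) d≢b)
    ...   | zs , eq′ , _ = regular-factor {p = Φ d} (prodₚ (map Φ zs))
            (regular-resp (ℙ.sym eq′) (regular-cofactor b 1≤b (ℙ.trans eq (prodₚ-Φ b 1≤b))))

    regular-xpow-1 : ∀ e → ¬ b ∣ e → Regular (Φ b) (xpow-1 e)
    regular-xpow-1 e b∤e x h = regular-g x (period-gcd b e period-b h)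
      where
      g : ℕ
      g = gcd b e
      1≤g : 1 ℕ.≤ g
      1≤g = ℕP.n≢0⇒n>0 λ g≡0 → ℕP.<⇒≢ 1≤b (sym (G.gcd[m,n]≡0⇒m≡0 g≡0))
      period-b : Period x b
      period-b = ∣≋-resp (ℙ.*-comm x (xpow-1 b)) (∣≋-*ˡ x (Φ∣xpow-1 b 1≤b ℕD.∣-refl))
      regular-g : Regular (Φ b) (xpow-1 g)
      regular-g = regular-resp (prodₚ-Φ g 1≤g) (regular-prodₚ Φ (divisorsℕ g) λ {d} d∈ →
        let d∣g = proj₂ (∈-divisorsℕ⁻ {d} {g} d∈) in
        regular-Φ (ℕD.∣-trans d∣g (G.gcd[m,n]∣m b e))
          (λ d≡b → b∤e (ℕD.∣-trans (subst (_∣ g) d≡b d∣g) (G.gcd[m,n]∣n b e))))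

    exactPower-xpow-1 : ∀ e → 1 ℕ.≤ e → ExactPower (Φ b) (xpow-1 e) (multiplicity b (+ e))
    exactPower-xpow-1 e 1≤e with b ∣? e
    ... | no  b∤e = regular⇒exactPower-0 (regular-xpow-1 e b∤e)
    ... | yes b∣e with Φ∣xpow-1 e 1≤e b∣e
    ...   | mk∣ u eq = exactPower u (ℙ.trans (ℙ.*-congʳ {u} (ℙ.*-identityʳ (Φ b))) eq) (regular-cofactor e 1≤e eq)

    exactPower-xpow : ∀ m → ExactPower (Φ b) (xpow m) 0
    exactPower-xpow m = regular⇒exactPower-0 (regular-xpow b 1≤b (Φ∣xpow-1 b 1≤b ℕD.∣-refl) m)

    exactPower-factor : ∀ e → ¬ IsZeroₚ (proj₁ (factor e)) →
      ExactPower (Φ b) (proj₁ (factor e)) (multiplicity b e) × ExactPower (Φ b) (proj₂ (factor e)) 0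
    exactPower-factor (+ zero)  nz = ⊥-elim (nz (refl ∷ []))
    exactPower-factor (+ suc m) _  =
      exactPower-neg (swap (xpow (suc m))) (exactPower-xpow-1 (suc m) (s≤s z≤n)) , exactPower-xpow 0
      where
      swap : ∀ a → negₚ (a +ₚ negₚ oneₚ) ≋ oneₚ +ₚ negₚ a
      swap = RS.solve-∀ poly-ring
    exactPower-factor -[1+ m ] _ = exactPower-xpow-1 (suc m) (s≤s z≤n) , exactPower-xpow (suc m)

    exactPower-factors : ∀ {es} → All (λ e → ¬ IsZeroₚ (proj₁ (factor e))) es →
      ExactPower (Φ b) (prodₚ (map proj₁ (map factor es))) (totalMultiplicity b es) ×
      ExactPower (Φ b) (prodₚ (map proj₂ (map factor es))) 0
    exactPower-factors [] = exactPower-xpow 0 , exactPower-xpow 0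
    exactPower-factors {e ∷ es} (nz ∷ nzs) with exactPower-factor e nz | exactPower-factors nzs
    ... | num , den | nums , dens = exactPower-* num nums , exactPower-* den dens

    ValFrac-poch⁺ : ∀ r s k → PochDefinedNonzero r s (+ k) →
      ValFrac (Φ b) (poch r s (+ k)) (+ totalMultiplicity b (pexps r s (+ k)))
    ValFrac-poch⁺ r s k nz with exactPower-factors nz | Φ-degree b 1≤b
    ... | num , den | _ , deg =
      totalMultiplicity b (pexps r s (+ k)) , 0 , exactPower⇒HasVal deg num , exactPower⇒HasVal deg den , sym (ℤP.+-identityʳ _)

    ValFrac-poch⁻ : ∀ r s k → PochDefinedNonzero r s -[1+ k ] →
      ValFrac (Φ b) (poch r s -[1+ k ]) (ℤ.- (+ totalMultiplicity b (pexps r s -[1+ k ])))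
    ValFrac-poch⁻ r s k nz with exactPower-factors nz | Φ-degree b 1≤b
    ... | num , den | _ , deg =
      0 , totalMultiplicity b (pexps r s -[1+ k ]) , exactPower⇒HasVal deg den , exactPower⇒HasVal deg num , sym (ℤP.+-identityˡ _)

-- Counting the exponents divisible by b

multiplicity-∣ : ∀ b e → b ∣ ∣ e ∣ → multiplicity b e ≡ 1
multiplicity-∣ b e b∣e = cong (if_then 1 else 0) (dec-true (b ∣? ∣ e ∣) b∣e)

multiplicity-∤ : ∀ b e → ¬ b ∣ ∣ e ∣ → multiplicity b e ≡ 0
multiplicity-∤ b e b∤e = cong (if_then 1 else 0) (dec-false (b ∣? ∣ e ∣) b∤e)

i-1<i : ∀ i → i ℤ.- 1ℤ ℤ.< i
i-1<i i = subst (i ℤ.- 1ℤ ℤ.<_) (ℤP.+-identityʳ i) (ℤP.+-monoʳ-< i ℤ.-<+)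

<suc⇒≤ : ∀ {i j} → i ℤ.< ℤ.suc j → i ℤ.≤ j
<suc⇒≤ {i} {j} i<1+j = subst (i ℤ.≤_) (ℤP.pred-suc j) (ℤP.i<j⇒i≤pred[j] i<1+j)

/ℕ-unique : ∀ x m .{{_ : ℕ.NonZero m}} q → q ℤ.* + m ℤ.≤ x → x ℤ.< ℤ.suc q ℤ.* + m → x /ℕ m ≡ q
/ℕ-unique x m@(suc _) q q*m≤x x<q*m = ℤP.≤-antisym
  (<suc⇒≤ (ℤP.*-cancelʳ-<-nonNeg (+ m) (ℤP.≤-<-trans (ℤD.[n/ℕd]*d≤n x m) x<q*m)))
  (<suc⇒≤ (ℤP.*-cancelʳ-<-nonNeg (+ m) (ℤP.≤-<-trans q*m≤x (ℤD.n<s[n/ℕd]*d x m))))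

-- For x = t m one has x - 1 = (t - 1) m + (m - 1), a division with admissible remainder, so the
-- quotient of x - 1 is t - 1.
/ℕ-step-∣ : ∀ x m .{{_ : ℕ.NonZero m}} → m ∣ ∣ x ∣ → x /ℕ m ≡ (x ℤ.- 1ℤ) /ℕ m ℤ.+ 1ℤ
/ℕ-step-∣ x m@(suc m-1) m∣x with ℤ∣.∣ᵤ⇒∣ {+ m} {x} m∣x
... | ℤ∣.divides t refl = trans
  (/ℕ-unique (t ℤ.* + m) m t ℤP.≤-refl (ℤP.*-monoʳ-<-pos (+ m) (ℤP.i≤pred[j]⇒i<j {t} {ℤ.suc t} (ℤP.≤-reflexive (sym (ℤP.pred-suc t))))))
  (trans (plus t) (cong (ℤ._+ 1ℤ) (sym (/ℕ-unique (t ℤ.* + m ℤ.- 1ℤ) m (t ℤ.- 1ℤ) lower upper))))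
  where
  plus : ∀ t → t ≡ t ℤ.- 1ℤ ℤ.+ 1ℤ
  plus = ℤSolver.solve-∀
  rearrange : ∀ t m → t ℤ.* (1ℤ ℤ.+ m) ℤ.- 1ℤ ≡ (t ℤ.- 1ℤ) ℤ.* (1ℤ ℤ.+ m) ℤ.+ m
  rearrange = ℤSolver.solve-∀
  suc-pred : ∀ t m → (1ℤ ℤ.+ (t ℤ.- 1ℤ)) ℤ.* m ≡ t ℤ.* m
  suc-pred = ℤSolver.solve-∀
  lower : (t ℤ.- 1ℤ) ℤ.* + m ℤ.≤ t ℤ.* + m ℤ.- 1ℤ
  lower = subst ((t ℤ.- 1ℤ) ℤ.* + m ℤ.≤_) (sym (rearrange t (+ m-1))) (ℤP.i≤i+j _ (+ m-1))
  upper : t ℤ.* + m ℤ.- 1ℤ ℤ.< ℤ.suc (t ℤ.- 1ℤ) ℤ.* + m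
  upper = subst (t ℤ.* + m ℤ.- 1ℤ ℤ.<_) (sym (suc-pred t (+ m))) (i-1<i (t ℤ.* + m))

-- From x - 1 < (q + 1) m follows x ≤ (q + 1) m, and equality is impossible when m does not divide
-- x.
/ℕ-step-∤ : ∀ x m .{{_ : ℕ.NonZero m}} → ¬ m ∣ ∣ x ∣ → x /ℕ m ≡ (x ℤ.- 1ℤ) /ℕ m
/ℕ-step-∤ x m m∤x = /ℕ-unique x m q
  (ℤP.≤-trans (ℤD.[n/ℕd]*d≤n (x ℤ.- 1ℤ) m) (ℤP.<⇒≤ (i-1<i x)))
  (ℤP.≤∧≢⇒< (subst (ℤ._≤ ℤ.suc q ℤ.* + m) (suc-minus x) (ℤP.i<j⇒suc[i]≤j (ℤD.n<s[n/ℕd]*d (x ℤ.- 1ℤ) m)))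
    (λ x≡ → m∤x (ℤ∣.∣⇒∣ᵤ (ℤ∣.divides (ℤ.suc q) x≡))))
  where
  q = (x ℤ.- 1ℤ) /ℕ m
  suc-minus : ∀ x → 1ℤ ℤ.+ (x ℤ.- 1ℤ) ≡ x
  suc-minus = ℤSolver.solve-∀

totalMultiplicity-telescope : ∀ b (h G : ℕ → ℤ) → (∀ i → + multiplicity b (h i) ≡ G (suc i) ℤ.- G i) →
  ∀ k → + totalMultiplicity b (applyUpTo h k) ≡ G k ℤ.- G 0
totalMultiplicity-telescope b h G step zero    = sym (ℤP.+-inverseʳ (G 0))
totalMultiplicity-telescope b h G step (suc k) = begin
  + (multiplicity b (h 0) ℕ.+ totalMultiplicity b (applyUpTo (h ∘ suc) k))
    ≡⟨ ℤP.pos-+ (multiplicity b (h 0)) _ ⟩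
  + multiplicity b (h 0) ℤ.+ + totalMultiplicity b (applyUpTo (h ∘ suc) k)
    ≡⟨ cong₂ ℤ._+_ (step 0) (totalMultiplicity-telescope b (h ∘ suc) (G ∘ suc) (step ∘ suc) k) ⟩
  G 1 ℤ.- G 0 ℤ.+ (G (suc k) ℤ.- G 1)
    ≡⟨ cancel (G 1) (G 0) (G (suc k)) ⟩
  G (suc k) ℤ.- G 0 ∎
  where
  open ≡-Reasoning
  cancel : ∀ x y z → x ℤ.- y ℤ.+ (z ℤ.- x) ≡ z ℤ.- y
  cancel = ℤSolver.solve-∀

signedTotal : ℕ → ℤ → ℤ → ℤ → ℤ
signedTotal b r s (+ k)    = + totalMultiplicity b (pexps r s (+ k))
signedTotal b r s -[1+ k ] = ℤ.- (+ totalMultiplicity b (pexps r s -[1+ k ]))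

-- `F` is a discrete antiderivative of the multiplicity on all of ℤ, normalised by F(0) = 0. For n ≥
-- 0 the sum over [0, n) is F(n); for n < 0 the sum over [n, 0) is -F(n), and the sign of the
-- denominator turns it into F(n) again.
signedTotal-telescope : ∀ b r s (F : ℤ → ℤ) → F 0ℤ ≡ 0ℤ →
  (∀ j → + multiplicity b (r ℤ.+ s ℤ.* j) ≡ F (j ℤ.+ 1ℤ) ℤ.- F j) → ∀ n → signedTotal b r s n ≡ F n
signedTotal-telescope b r s F F0 step (+ k) = begin
  + totalMultiplicity b (pexps r s (+ k))  ≡⟨ totalMultiplicity-telescope b _ (F ∘ +_) step⁺ k ⟩
  F (+ k) ℤ.- F 0ℤ                         ≡⟨ cong (λ z → F (+ k) ℤ.- z) F0 ⟩
  F (+ k) ℤ.- 0ℤ                           ≡⟨ ℤP.+-identityʳ _ ⟩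
  F (+ k)                                  ∎
  where
  open ≡-Reasoning
  step⁺ : ∀ i → + multiplicity b (r ℤ.+ s ℤ.* + i) ≡ F (+ suc i) ℤ.- F (+ i)
  step⁺ i = trans (step (+ i)) (cong (λ z → F z ℤ.- F (+ i)) (cong +_ (ℕP.+-comm i 1)))
signedTotal-telescope b r s F F0 step -[1+ k ] = begin
  ℤ.- (+ totalMultiplicity b (pexps r s -[1+ k ]))
    -- The exponents are listed downwards, for j = -1, -2, and so on, so the antiderivative along
    -- the list is i ↦ -F(-i).
    ≡⟨ cong ℤ.-_ (totalMultiplicity-telescope b (λ i → r ℤ.- + suc i ℤ.* s) (λ i → ℤ.- F (ℤ.- + i)) step⁻ (suc k)) ⟩
  ℤ.- (ℤ.- F -[1+ k ] ℤ.- ℤ.- F 0ℤ)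
    ≡⟨ cong (λ z → ℤ.- (ℤ.- F -[1+ k ] ℤ.- ℤ.- z)) F0 ⟩
  ℤ.- (ℤ.- F -[1+ k ] ℤ.- ℤ.- 0ℤ)
    ≡⟨ simplify (F -[1+ k ]) ⟩
  F -[1+ k ] ∎
  where
  open ≡-Reasoning
  simplify : ∀ x → ℤ.- (ℤ.- x ℤ.- ℤ.- 0ℤ) ≡ x
  simplify = ℤSolver.solve-∀
  exponent : ∀ r s i → r ℤ.- (1ℤ ℤ.+ i) ℤ.* s ≡ r ℤ.+ s ℤ.* (ℤ.- (1ℤ ℤ.+ i))
  exponent = ℤSolver.solve-∀
  next : ∀ i → ℤ.- (1ℤ ℤ.+ i) ℤ.+ 1ℤ ≡ ℤ.- i
  next = ℤSolver.solve-∀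
  swap : ∀ x y → x ℤ.- y ≡ ℤ.- y ℤ.- ℤ.- x
  swap = ℤSolver.solve-∀
  step⁻ : ∀ i → + multiplicity b (r ℤ.- + suc i ℤ.* s) ≡ ℤ.- F (ℤ.- + suc i) ℤ.- ℤ.- F (ℤ.- + i)
  step⁻ i = begin
    + multiplicity b (r ℤ.- + suc i ℤ.* s)            ≡⟨ cong (λ e → + multiplicity b e) (exponent r s (+ i)) ⟩
    + multiplicity b (r ℤ.+ s ℤ.* (ℤ.- + suc i))      ≡⟨ step (ℤ.- + suc i) ⟩
    F (ℤ.- + suc i ℤ.+ 1ℤ) ℤ.- F (ℤ.- + suc i)        ≡⟨ cong (λ z → F z ℤ.- F (ℤ.- + suc i)) (next (+ i)) ⟩
    F (ℤ.- + i) ℤ.- F (ℤ.- + suc i)                   ≡⟨ swap (F (ℤ.- + i)) _ ⟩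
    ℤ.- F (ℤ.- + suc i) ℤ.- ℤ.- F (ℤ.- + i)           ∎

module _ {r s : ℤ} {b b′ c : ℕ} (r′ s′ : ℤ) {{_ : ℕ.NonZero b′}} {{_ : ℕ.NonZero c}}
  (b≡ : b ≡ b′ ℕ.* c) (r≡ : r ≡ r′ ℤ.* + c) (s≡ : s ≡ s′ ℤ.* + c) where

  exponent-factor : ∀ j → r ℤ.+ s ℤ.* j ≡ (r′ ℤ.+ s′ ℤ.* j) ℤ.* + c
  exponent-factor j = trans (cong₂ (λ x y → x ℤ.+ y ℤ.* j) r≡ s≡) (collect r′ s′ j (+ c))
    where
    collect : ∀ r s j c → r ℤ.* c ℤ.+ s ℤ.* c ℤ.* j ≡ (r ℤ.+ s ℤ.* j) ℤ.* c
    collect = ℤSolver.solve-∀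

  abs-exponent : ∀ j → ∣ r ℤ.+ s ℤ.* j ∣ ≡ ∣ r′ ℤ.+ s′ ℤ.* j ∣ ℕ.* c
  abs-exponent j = trans (cong ∣_∣ (exponent-factor j)) (ℤP.abs-* (r′ ℤ.+ s′ ℤ.* j) (+ c))

  b∣⇒b′∣ : ∀ j → b ∣ ∣ r ℤ.+ s ℤ.* j ∣ → b′ ∣ ∣ r′ ℤ.+ s′ ℤ.* j ∣
  b∣⇒b′∣ j h = ℕD.*-cancelʳ-∣ c (subst₂ _∣_ b≡ (abs-exponent j) h)

  b′∣⇒b∣ : ∀ j → b′ ∣ ∣ r′ ℤ.+ s′ ℤ.* j ∣ → b ∣ ∣ r ℤ.+ s ℤ.* j ∣
  b′∣⇒b∣ j h = subst₂ _∣_ (sym b≡) (sym (abs-exponent j)) (ℕD.*-monoˡ-∣ c h)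

  -- If b divides some r + s j, then a common divisor d of s′ and b′ also divides r′, so d c divides
  -- r, s and b, and maximality of c gives d = 1. Without coprimality no exponent is therefore
  -- divisible by b, and the zero function serves as antiderivative.
  signedTotal-noncoprime : (∀ d → d ℕ.* c ∣ ∣ r ∣ → d ℕ.* c ∣ ∣ s ∣ → d ℕ.* c ∣ b → d ≡ 1) →
    ¬ Coprime ∣ s′ ∣ b′ → ∀ n → signedTotal b r s n ≡ 0ℤ
  signedTotal-noncoprime maximal noncoprime = signedTotal-telescope b r s (λ _ → 0ℤ) refl
    λ j → cong +_ (multiplicity-∤ b (r ℤ.+ s ℤ.* j) (never j))
    where
    never : ∀ j → ¬ b ∣ ∣ r ℤ.+ s ℤ.* j ∣
    never j h = noncoprime coprime
      where
      coprime : Coprime ∣ s′ ∣ b′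
      coprime {d} (d∣s′ , d∣b′) = maximal d (lift r′ r≡ d∣r′) (lift s′ s≡ d∣s′)
        (subst (d ℕ.* c ∣_) (sym b≡) (ℕD.*-monoˡ-∣ c d∣b′))
        where
        lift : ∀ {z} z′ → z ≡ z′ ℤ.* + c → d ∣ ∣ z′ ∣ → d ℕ.* c ∣ ∣ z ∣
        lift {z} z′ eq h = subst (d ℕ.* c ∣_) (sym (trans (cong ∣_∣ eq) (ℤP.abs-* z′ (+ c)))) (ℕD.*-monoˡ-∣ c h)
        d∣r′ : d ∣ ∣ r′ ∣
        d∣r′ = ℤ∣.∣⇒∣ᵤ (ℤ∣.∣m+n∣n⇒∣m {m = r′} (ℤ∣.∣ᵤ⇒∣ (ℕD.∣-trans d∣b′ (b∣⇒b′∣ j h)))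
          (ℤ∣.∣m⇒∣m*n {+ d} {s′} j (ℤ∣.∣ᵤ⇒∣ d∣s′)))

  -- The antiderivative is ⌈(j - k)/b′⌉ written as a floor; it grows by one from j to j + 1 exactly
  -- when b′ ∣ j - k. Since r′ + s′ j = (r′ + s′ k) + s′ (j - k) and s′ is invertible modulo b′,
  -- this is the condition b ∣ r + s j.
  signedTotal-coprime : Coprime ∣ s′ ∣ b′ → ∀ {k} → k ℕ.< b′ → b′ ∣ ∣ r′ ℤ.+ s′ ℤ.* + k ∣ →
    ∀ n → signedTotal b r s n ≡ (n ℤ.- + k ℤ.- 1ℤ) /ℕ b′ ℤ.+ 1ℤ
  signedTotal-coprime coprime {k} k<b′ b′∣k = signedTotal-telescope b r s F F0 step
    where
    F : ℤ → ℤ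
    F j = (j ℤ.- + k ℤ.- 1ℤ) /ℕ b′ ℤ.+ 1ℤ
    F0 : F 0ℤ ≡ 0ℤ
    -- The range 0 ≤ k < b′ puts -k - 1 into [-b′, 0), where the quotient is -1; any other
    -- representative of k modulo b′ would shift F(0) away from 0.
    F0 = cong (ℤ._+ 1ℤ) (/ℕ-unique (0ℤ ℤ.- + k ℤ.- 1ℤ) b′ ℤ.-1ℤ lower upper)
      where
      flip : ∀ k → ℤ.- (1ℤ ℤ.+ k) ≡ 0ℤ ℤ.- k ℤ.- 1ℤ
      flip = ℤSolver.solve-∀
      lower : ℤ.-1ℤ ℤ.* + b′ ℤ.≤ 0ℤ ℤ.- + k ℤ.- 1ℤ
      lower = subst₂ ℤ._≤_ (sym (ℤP.-1*i≡-i (+ b′))) (flip (+ k)) (ℤP.neg-mono-≤ (ℤ.+≤+ k<b′))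
      upper : 0ℤ ℤ.- + k ℤ.- 1ℤ ℤ.< 0ℤ ℤ.* + b′
      upper = subst₂ ℤ._<_ (flip (+ k)) (sym (ℤP.*-zeroˡ (+ b′))) ℤ.-<+
    shift : ∀ r s k j → r ℤ.+ s ℤ.* j ≡ (r ℤ.+ s ℤ.* k) ℤ.+ s ℤ.* (j ℤ.- k)
    shift = ℤSolver.solve-∀
    b′∣j-k⇒b∣ : ∀ j → b′ ∣ ∣ j ℤ.- + k ∣ → b ∣ ∣ r ℤ.+ s ℤ.* j ∣
    b′∣j-k⇒b∣ j h = b′∣⇒b∣ j (subst (λ z → b′ ∣ ∣ z ∣) (sym (shift r′ s′ (+ k) j))
      (ℤ∣.∣⇒∣ᵤ (ℤ∣.∣m∣n⇒∣m+n {+ b′} {r′ ℤ.+ s′ ℤ.* + k} (ℤ∣.∣ᵤ⇒∣ b′∣k) (ℤ∣.∣n⇒∣m*n s′ (ℤ∣.∣ᵤ⇒∣ h)))))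
    b∣⇒b′∣j-k : ∀ j → b ∣ ∣ r ℤ.+ s ℤ.* j ∣ → b′ ∣ ∣ j ℤ.- + k ∣
    b∣⇒b′∣j-k j h = coprime-divisor (Coprimality.sym coprime) (subst (b′ ∣_) (ℤP.abs-* s′ (j ℤ.- + k))
      (ℤ∣.∣⇒∣ᵤ (ℤ∣.∣m+n∣m⇒∣n {+ b′} {r′ ℤ.+ s′ ℤ.* + k}
        (ℤ∣.∣ᵤ⇒∣ (subst (λ z → b′ ∣ ∣ z ∣) (shift r′ s′ (+ k) j) (b∣⇒b′∣ j h))) (ℤ∣.∣ᵤ⇒∣ b′∣k))))
    succ : ∀ j k → j ℤ.+ 1ℤ ℤ.- k ℤ.- 1ℤ ≡ j ℤ.- k
    succ = ℤSolver.solve-∀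
    difference : ∀ q → 1ℤ ≡ (q ℤ.+ 1ℤ ℤ.+ 1ℤ) ℤ.- (q ℤ.+ 1ℤ)
    difference = ℤSolver.solve-∀
    step : ∀ j → + multiplicity b (r ℤ.+ s ℤ.* j) ≡ F (j ℤ.+ 1ℤ) ℤ.- F j
    step j with b′ ∣? ∣ j ℤ.- + k ∣
    ... | yes h = trans (cong +_ (multiplicity-∣ b (r ℤ.+ s ℤ.* j) (b′∣j-k⇒b∣ j h)))
            (trans (difference ((j ℤ.- + k ℤ.- 1ℤ) /ℕ b′))
              (cong (λ z → (z ℤ.+ 1ℤ) ℤ.- F j) (sym (trans (cong (_/ℕ b′) (succ j (+ k))) (/ℕ-step-∣ (j ℤ.- + k) b′ h)))))
    ... | no ¬h = trans (cong +_ (multiplicity-∤ b (r ℤ.+ s ℤ.* j) (¬h ∘ b∣⇒b′∣j-k j)))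
            (trans (sym (ℤP.+-inverseʳ (F j)))
              (cong (λ z → (z ℤ.+ 1ℤ) ℤ.- F j) (sym (trans (cong (_/ℕ b′) (succ j (+ k))) (/ℕ-step-∤ (j ℤ.- + k) b′ ¬h)))))

-- Floors and the Dwork map

ℚ-ring : AlmostCommutativeRing 0ℓ 0ℓ
ℚ-ring = fromCommutativeRing ℚP.+-*-commutativeRing (λ p → dec⇒maybe (ℚ.0ℚ ℚP.≟ p))

-- Written directly in lowest terms, so that `↥` and `↧` compute on `ι z` for a variable `z`;
-- `z ℚ./ 1` gets stuck in its normalisation by a gcd.
ι : ℤ → ℚ
ι z = mkℚ z 0 (Coprimality.sym (Coprimality.1-coprimeTo ∣ z ∣))

/1≡ι : ∀ z → z ℚ./ 1 ≡ ι z
/1≡ι z = ℚP.↥p/↧p≡p (ι z)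

ι-injective : ∀ {x y} → ι x ≡ ι y → x ≡ y
ι-injective = cong ↥_

ι-+ : ∀ x y → ι (x ℤ.+ y) ≡ ι x ℚ.+ ι y
ι-+ x y = trans (sym (/1≡ι (x ℤ.+ y)))
  (cong (ℚ._/ 1) (sym (cong₂ ℤ._+_ (ℤP.*-identityʳ x) (ℤP.*-identityʳ y))))

ι-* : ∀ x y → ι (x ℤ.* y) ≡ ι x ℚ.* ι y
ι-* x y = sym (/1≡ι (x ℤ.* y))

ι-neg : ∀ x → ι (ℤ.- x) ≡ ℚ.- ι x
ι-neg (+ zero)  = refl
ι-neg (+ suc _) = refl
ι-neg -[1+ _ ]  = refl

ι-minus : ∀ x y → ι (x ℤ.- y) ≡ ι x ℚ.- ι y
ι-minus x y = trans (ι-+ x (ℤ.- y)) (cong (ι x ℚ.+_) (ι-neg y))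

ι-mono-≤ : ∀ {x y} → x ℤ.≤ y → ι x ℚ.≤ ι y
ι-mono-≤ x≤y = ℚ.*≤* (ℤP.*-monoʳ-≤-nonNeg 1ℤ x≤y)

ι-cancel-< : ∀ {x y} → ι x ℚ.< ι y → x ℤ.< y
ι-cancel-< (ℚ.*<* h) = ℤP.*-cancelʳ-<-nonNeg 1ℤ h

instance
  ι-positive : ∀ {m} → ℚ.Positive (ι (+ suc m))
  ι-positive = _

*ι-cancelʳ : ∀ {p q} m → p ℚ.* ι (+ suc m) ≡ q ℚ.* ι (+ suc m) → p ≡ q
*ι-cancelʳ m e = ℚP.≤-antisym
  (ℚP.*-cancelʳ-≤-pos (ι (+ suc m)) (ℚP.≤-reflexive e))
  (ℚP.*-cancelʳ-≤-pos (ι (+ suc m)) (ℚP.≤-reflexive (sym e)))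

÷*ι : ∀ x m → (x ÷ suc m) ℚ.* ι (+ suc m) ≡ ι x
÷*ι x m = ℚP.toℚᵘ-injective (begin
  toℚᵘ ((x ℚ./ suc m) ℚ.* ι (+ suc m))          ≈⟨ ℚP.toℚᵘ-homo-* (x ℚ./ suc m) (ι (+ suc m)) ⟩
  toℚᵘ (x ℚ./ suc m) ℚᵘ.* mkℚᵘ (+ suc m) 0      ≈⟨ ℚᵘP.*-congʳ {mkℚᵘ (+ suc m) 0} (ℚP.toℚᵘ-fromℚᵘ (mkℚᵘ x m)) ⟩
  mkℚᵘ x m ℚᵘ.* mkℚᵘ (+ suc m) 0                ≈⟨ *≡* (trans (ℤP.*-identityʳ _) (cong (λ d → x ℤ.* + suc d) (sym (ℕP.*-identityʳ m)))) ⟩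
  mkℚᵘ x 0                                      ∎)
  where open ≃-Reasoning

ratio*ι : ∀ r s → s ≢ 0ℤ → ratio r s ℚ.* ι s ≡ ι r
ratio*ι r (+ zero)  s≢0 = ⊥-elim (s≢0 refl)
ratio*ι r (+ suc k) _   = ÷*ι r k
ratio*ι r -[1+ k ]  _   = begin
  ((ℤ.- r) ÷ suc k) ℚ.* ℚ.- ι (+ suc k)     ≡⟨ out ((ℤ.- r) ÷ suc k) (ι (+ suc k)) ⟩
  ℚ.- (((ℤ.- r) ÷ suc k) ℚ.* ι (+ suc k))   ≡⟨ cong ℚ.-_ (÷*ι (ℤ.- r) k) ⟩
  ℚ.- ι (ℤ.- r)                             ≡⟨ ι-neg (ℤ.- r) ⟨
  ι (ℤ.- ℤ.- r)                             ≡⟨ cong ι (ℤP.neg-involutive r) ⟩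
  ι r                                       ∎
  where
  open ≡-Reasoning
  out : ∀ x y → x ℚ.* ℚ.- y ≡ ℚ.- (x ℚ.* y)
  out = RS.solve-∀ ℚ-ring

↥≡*ι↧ : ∀ p → p ℚ.* ι (↧ p) ≡ ι (↥ p)
↥≡*ι↧ p@(mkℚ n d _) = trans (cong (ℚ._* ι (+ suc d)) (sym (ℚP.↥p/↧p≡p p))) (÷*ι n d)

floor≤ : ∀ p → ι (floor p) ℚ.≤ p
floor≤ (mkℚ n d _) = ℚ.*≤* (subst (floor′ ℤ.* + suc d ℤ.≤_) (sym (ℤP.*-identityʳ n)) (ℤD.[n/d]*d≤n n (+ suc d)))
  where
  floor′ = n ℤD./ + suc d

<1+floor : ∀ p → p ℚ.< ι (ℤ.suc (floor p))
<1+floor (mkℚ n d _) = ℚ.*<* (subst₂ ℤ._<_ (sym (ℤP.*-identityʳ n))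
  (cong (λ q → ℤ.suc q ℤ.* + suc d) (sym (ℤD.div-pos-is-/ℕ n (suc d)))) (ℤD.n<s[n/ℕd]*d n (suc d)))

floor-unique : ∀ {p q} → ι q ℚ.≤ p → p ℚ.< ι (ℤ.suc q) → floor p ≡ q
floor-unique {p} {q} q≤p p<1+q = ℤP.≤-antisym
  (<suc⇒≤ (ι-cancel-< (ℚP.≤-<-trans (floor≤ p) p<1+q)))
  (<suc⇒≤ (ι-cancel-< (ℚP.≤-<-trans q≤p (<1+floor p))))

module _ {m k : ℕ} {n : ℤ} (α D C E : ℚ)
  (Dwork : ι (+ suc m) ℚ.* D ℚ.- α ≡ ι (+ k)) (C≡ : C ℚ.* ι (+ suc m) ≡ ι n)
  (E≡ : E ℚ.* ι (+ suc m) ≡ ι (floor (1ℚ ℚ.- α))) where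

  -- Scaled by b′ = m + 1, the argument of the floor is n - k - 1 plus the fractional part of 1 - α.
  floor-formula : floor (C ℚ.- D ℚ.- E) ≡ (n ℤ.- + k ℤ.- 1ℤ) /ℕ suc m
  floor-formula = floor-unique {C ℚ.- D ℚ.- E} {q}
    (ℚP.*-cancelʳ-≤-pos M (ℚP.≤-trans (subst (ℚ._≤ ι (n ℤ.- + k ℤ.- 1ℤ)) (ι-* q (+ suc m)) (ι-mono-≤ (ℤD.[n/ℕd]*d≤n _ (suc m)))) lower))
    (ℚP.*-cancelʳ-<-nonNeg M (ℚP.<-≤-trans upper (subst (ι (n ℤ.- + k) ℚ.≤_) (ι-* (ℤ.suc q) (+ suc m))
      (ι-mono-≤ (subst (ℤ._≤ ℤ.suc q ℤ.* + suc m) (suc-minus (n ℤ.- + k)) (ℤP.i<j⇒suc[i]≤j (ℤD.n<s[n/ℕd]*d (n ℤ.- + k ℤ.- 1ℤ) (suc m))))))))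
    where
    open ≡-Reasoning
    M f shift : ℚ
    M = ι (+ suc m)
    f = ι (floor (1ℚ ℚ.- α))
    -- Adding `shift` to f ≤ 1 - α < f + 1 places the scaled argument between the consecutive
    -- integers n - k - 1 and n - k, so its fractional part cannot affect the quotient by `suc m`.
    shift = ι n ℚ.- ι (+ k) ℚ.- 1ℚ ℚ.- f
    q : ℤ
    q = (n ℤ.- + k ℤ.- 1ℤ) /ℕ suc m
    suc-minus : ∀ x → 1ℤ ℤ.+ (x ℤ.- 1ℤ) ≡ x
    suc-minus = ℤSolver.solve-∀
    scaled : (1ℚ ℚ.- α) ℚ.+ shift ≡ (C ℚ.- D ℚ.- E) ℚ.* M
    scaled = begin
      (1ℚ ℚ.- α) ℚ.+ (ι n ℚ.- ι (+ k) ℚ.- 1ℚ ℚ.- f)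
        ≡⟨ cong₂ (λ x y → (1ℚ ℚ.- α) ℚ.+ (x ℚ.- y ℚ.- 1ℚ ℚ.- f)) (sym C≡) (sym Dwork) ⟩
      (1ℚ ℚ.- α) ℚ.+ (C ℚ.* M ℚ.- (M ℚ.* D ℚ.- α) ℚ.- 1ℚ ℚ.- f)
        ≡⟨ cong (λ x → (1ℚ ℚ.- α) ℚ.+ (C ℚ.* M ℚ.- (M ℚ.* D ℚ.- α) ℚ.- 1ℚ ℚ.- x)) (sym E≡) ⟩
      (1ℚ ℚ.- α) ℚ.+ (C ℚ.* M ℚ.- (M ℚ.* D ℚ.- α) ℚ.- 1ℚ ℚ.- E ℚ.* M)
        ≡⟨ collect α C M D E ⟩
      (C ℚ.- D ℚ.- E) ℚ.* M ∎
      where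
      collect : ∀ α C M D E → (1ℚ ℚ.- α) ℚ.+ (C ℚ.* M ℚ.- (M ℚ.* D ℚ.- α) ℚ.- 1ℚ ℚ.- E ℚ.* M) ≡ (C ℚ.- D ℚ.- E) ℚ.* M
      collect = RS.solve-∀ ℚ-ring
    lower : ι (n ℤ.- + k ℤ.- 1ℤ) ℚ.≤ (C ℚ.- D ℚ.- E) ℚ.* M
    lower = subst₂ ℚ._≤_ (begin
      f ℚ.+ shift                          ≡⟨ cancel f (ι n) (ι (+ k)) ⟩
      ι n ℚ.- ι (+ k) ℚ.- 1ℚ               ≡⟨ cong (ℚ._- 1ℚ) (ι-minus n (+ k)) ⟨
      ι (n ℤ.- + k) ℚ.- 1ℚ                 ≡⟨ ι-minus (n ℤ.- + k) 1ℤ ⟨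
      ι (n ℤ.- + k ℤ.- 1ℤ)                 ∎) scaled (ℚP.+-monoˡ-≤ shift (floor≤ (1ℚ ℚ.- α)))
      where
      cancel : ∀ f n k → f ℚ.+ (n ℚ.- k ℚ.- 1ℚ ℚ.- f) ≡ n ℚ.- k ℚ.- 1ℚ
      cancel = RS.solve-∀ ℚ-ring
    upper : (C ℚ.- D ℚ.- E) ℚ.* M ℚ.< ι (n ℤ.- + k)
    upper = subst₂ ℚ._<_ scaled (begin
      ι (ℤ.suc (floor (1ℚ ℚ.- α))) ℚ.+ shift   ≡⟨ cong (ℚ._+ shift) (ι-+ 1ℤ (floor (1ℚ ℚ.- α))) ⟩
      1ℚ ℚ.+ f ℚ.+ shift                       ≡⟨ cancel f (ι n) (ι (+ k)) ⟩
      ι n ℚ.- ι (+ k)                          ≡⟨ ι-minus n (+ k) ⟨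
      ι (n ℤ.- + k)                            ∎) (ℚP.+-monoˡ-< shift (<1+floor (1ℚ ℚ.- α)))
      where
      cancel : ∀ f n k → 1ℚ ℚ.+ f ℚ.+ (n ℚ.- k ℚ.- 1ℚ ℚ.- f) ≡ n ℚ.- k
      cancel = RS.solve-∀ ℚ-ring

-- Since k = m D - α and α s = r, one has r + s k = s m D. Writing D = x/y and cancelling c gives y
-- (r′ + s′ k) = x s′ m, and y is coprime to m.
Dwork⇒∣ : ∀ {m k c r s} r′ s′ α D {{_ : ℕ.NonZero c}} → r ≡ r′ ℤ.* + c → s ≡ s′ ℤ.* + c →
  α ℚ.* ι s ≡ ι r → Coprime (↧ₙ D) m → ι (+ m) ℚ.* D ℚ.- α ≡ ι (+ k) → m ∣ ∣ r′ ℤ.+ s′ ℤ.* + k ∣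
Dwork⇒∣ {m} {k} {c@(suc _)} {r} {s} r′ s′ α D r≡ s≡ α*s≡r coprime Dwork =
  coprime-divisor (Coprimality.sym coprime) (subst (m ∣_) (ℤP.abs-* (↧ D) (r′ ℤ.+ s′ ℤ.* + k))
    (ℤ∣.∣⇒∣ᵤ (ℤ∣.divides (↥ D ℤ.* s′) (ℤP.*-cancelʳ-≡ (↧ D ℤ.* (r′ ℤ.+ s′ ℤ.* + k)) (↥ D ℤ.* s′ ℤ.* + m) (+ c) (begin
      ↧ D ℤ.* (r′ ℤ.+ s′ ℤ.* + k) ℤ.* + c                       ≡⟨ expand (↧ D) r′ s′ (+ k) (+ c) ⟩
      ↧ D ℤ.* (r′ ℤ.* + c ℤ.+ s′ ℤ.* + c ℤ.* + k)               ≡⟨ cong₂ (λ x y → ↧ D ℤ.* (x ℤ.+ y ℤ.* + k)) r≡ s≡ ⟨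
      ↧ D ℤ.* (r ℤ.+ s ℤ.* + k)                                 ≡⟨ ι-injective cleared ⟩
      ↥ D ℤ.* s ℤ.* + m                                         ≡⟨ cong (λ x → ↥ D ℤ.* x ℤ.* + m) s≡ ⟩
      ↥ D ℤ.* (s′ ℤ.* + c) ℤ.* + m                              ≡⟨ reorder (↥ D) s′ (+ c) (+ m) ⟩
      ↥ D ℤ.* s′ ℤ.* + m ℤ.* + c                                ∎)))))
  where
  open ≡-Reasoning
  expand : ∀ y r s k c → y ℤ.* (r ℤ.+ s ℤ.* k) ℤ.* c ≡ y ℤ.* (r ℤ.* c ℤ.+ s ℤ.* c ℤ.* k)
  expand = ℤSolver.solve-∀
  reorder : ∀ x s c m → x ℤ.* (s ℤ.* c) ℤ.* m ≡ x ℤ.* s ℤ.* m ℤ.* c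
  reorder = ℤSolver.solve-∀
  collect : ∀ y α s m D → y ℚ.* (α ℚ.* s ℚ.+ s ℚ.* (m ℚ.* D ℚ.- α)) ≡ D ℚ.* y ℚ.* s ℚ.* m
  collect = RS.solve-∀ ℚ-ring
  cleared : ι (↧ D ℤ.* (r ℤ.+ s ℤ.* + k)) ≡ ι (↥ D ℤ.* s ℤ.* + m)
  cleared = begin
    ι (↧ D ℤ.* (r ℤ.+ s ℤ.* + k))                              ≡⟨ ι-* (↧ D) _ ⟩
    ι (↧ D) ℚ.* ι (r ℤ.+ s ℤ.* + k)                            ≡⟨ cong (ι (↧ D) ℚ.*_) (trans (ι-+ r _) (cong (ι r ℚ.+_) (ι-* s (+ k)))) ⟩
    ι (↧ D) ℚ.* (ι r ℚ.+ ι s ℚ.* ι (+ k))                      ≡⟨ cong₂ (λ x y → ι (↧ D) ℚ.* (x ℚ.+ ι s ℚ.* y)) α*s≡r Dwork ⟨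
    ι (↧ D) ℚ.* (α ℚ.* ι s ℚ.+ ι s ℚ.* (ι (+ m) ℚ.* D ℚ.- α))  ≡⟨ collect (ι (↧ D)) α (ι s) (ι (+ m)) D ⟩
    D ℚ.* ι (↧ D) ℚ.* ι s ℚ.* ι (+ m)                          ≡⟨ cong (λ x → x ℚ.* ι s ℚ.* ι (+ m)) (↥≡*ι↧ D) ⟩
    ι (↥ D) ℚ.* ι s ℚ.* ι (+ m)                                ≡⟨ cong (ℚ._* ι (+ m)) (ι-* (↥ D) s) ⟨
    ι (↥ D ℤ.* s) ℚ.* ι (+ m)                                  ≡⟨ ι-* (↥ D ℤ.* s) (+ m) ⟨
    ι (↥ D ℤ.* s ℤ.* + m)                                      ∎

scaled-÷ : ∀ b b′ c n → b ≡ suc b′ ℕ.* suc c → ((+ suc c ℤ.* n) ÷ b) ℚ.* ι (+ suc b′) ≡ ι n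
scaled-÷ b b′ c n refl = *ι-cancelʳ c (begin
  x ℚ.* ι (+ suc b′) ℚ.* ι (+ suc c)     ≡⟨ ℚP.*-assoc x (ι (+ suc b′)) (ι (+ suc c)) ⟩
  x ℚ.* (ι (+ suc b′) ℚ.* ι (+ suc c))   ≡⟨ cong (x ℚ.*_) (ι-* (+ suc b′) (+ suc c)) ⟨
  x ℚ.* ι (+ (suc b′ ℕ.* suc c))         ≡⟨ ÷*ι (+ suc c ℤ.* n) (c ℕ.+ b′ ℕ.* suc c) ⟩
  ι (+ suc c ℤ.* n)                      ≡⟨ cong ι (ℤP.*-comm (+ suc c) n) ⟩
  ι (n ℤ.* + suc c)                      ≡⟨ ι-* n (+ suc c) ⟩
  ι n ℚ.* ι (+ suc c)                    ∎)
  where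
  open ≡-Reasoning
  x = (+ suc c ℤ.* n) ÷ (suc b′ ℕ.* suc c)

-- The valuation of (q^r;q^s)_n as a signed count and in closed form

ValFrac-poch : ∀ {Φ} → IsCyclotomicFamily Φ → ∀ {b} → 1 ≤ b → ∀ r s n → PochDefinedNonzero r s n →
  ValFrac (Φ b) (poch r s n) (signedTotal b r s n)
ValFrac-poch cyclotomic 1≤b r s (+ k)    = ValFrac-poch⁺ cyclotomic 1≤b r s k
ValFrac-poch cyclotomic 1≤b r s -[1+ k ] = ValFrac-poch⁻ cyclotomic 1≤b r s k

theorem1p1 : (r s : ℤ) → s ≢ 0ℤ → (b : ℕ) → 1 ≤ b →
    (Φ : ℕ → Poly) → IsCyclotomicFamily Φ →
    (n : ℤ) → PochDefinedNonzero r s n →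
    (b' : ℕ) → (s' : ℤ) →
    b ≡ b' * gcd (gcd ∣ r ∣ ∣ s ∣) b →
    s ≡ s' ℤ.* (+ gcd (gcd ∣ r ∣ ∣ s ∣) b) →
    ((Coprime ∣ s' ∣ b' → (D : ℚ) → IsDwork b' (ratio r s) D →
    ValFrac (Φ b) (poch r s n)
    (floor (((+ gcd (gcd ∣ r ∣ ∣ s ∣) b) ℤ.* n) ÷ b
    ℚ.- D
    ℚ.- (floor (1ℚ ℚ.- ratio r s) ÷ b')) ℤ.+ 1ℤ))
    × (¬ Coprime ∣ s' ∣ b' → ValFrac (Φ b) (poch r s n) 0ℤ))
theorem1p1 r s s≢0 b 1≤b Φ cyclotomic n nz b' s' b≡ s≡
  -- The gcd is abstracted together with the two facts that characterise it as c, so that both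
  -- survive the case split; the cases c = 0 and b′ = 0 contradict 1 ≤ b.
  with gcd (gcd ∣ r ∣ ∣ s ∣) b
     | gcd[m,n]∣m (gcd ∣ r ∣ ∣ s ∣) b
     | (λ {d} → gcd-greatest {gcd ∣ r ∣ ∣ s ∣} {b} {d})
... | 0     | _     | _        = ⊥-elim (ℕP.<⇒≢ 1≤b (sym (trans b≡ (ℕP.*-zeroʳ b'))))
... | suc c | c∣gcd | greatest with b'
...   | 0       = ⊥-elim (ℕP.<⇒≢ 1≤b (sym b≡))
...   | suc b'' with ℤ∣.∣ᵤ⇒∣ {+ suc c} {r} (ℕD.∣-trans c∣gcd (gcd[m,n]∣m ∣ r ∣ ∣ s ∣))
...     | ℤ∣.divides r′ r≡ = coprime-case , noncoprime-case
  where
  valuation : ∀ {v} → signedTotal b r s n ≡ v → ValFrac (Φ b) (poch r s n) v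
  valuation eq = subst (ValFrac (Φ b) (poch r s n)) eq (ValFrac-poch cyclotomic 1≤b r s n nz)
  coprime-case : Coprime ∣ s' ∣ (suc b'') → (D : ℚ) → IsDwork (suc b'') (ratio r s) D →
    ValFrac (Φ b) (poch r s n)
      (floor ((+ suc c ℤ.* n) ÷ b ℚ.- D ℚ.- (floor (1ℚ ℚ.- ratio r s) ÷ suc b'')) ℤ.+ 1ℤ)
  coprime-case coprime D (coprimeD , k , k<b' , Dwork) = valuation (trans
    (signedTotal-coprime r′ s' b≡ r≡ s≡ coprime k<b' (Dwork⇒∣ r′ s' (ratio r s) D r≡ s≡ (ratio*ι r s s≢0) coprimeD Dworkι) n)
    (cong (ℤ._+ 1ℤ) (sym (floor-formula (ratio r s) D
      ((+ suc c ℤ.* n) ÷ b) (floor (1ℚ ℚ.- ratio r s) ÷ suc b'')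
      Dworkι (scaled-÷ b b'' c n b≡) (÷*ι (floor (1ℚ ℚ.- ratio r s)) b'')))))
    where
    Dworkι : ι (+ suc b'') ℚ.* D ℚ.- ratio r s ≡ ι (+ k)
    Dworkι = subst₂ (λ x y → x ℚ.* D ℚ.- ratio r s ≡ y) (/1≡ι (+ suc b'')) (/1≡ι (+ k)) Dwork
  noncoprime-case : ¬ Coprime ∣ s' ∣ (suc b'') → ValFrac (Φ b) (poch r s n) 0ℤ
  noncoprime-case noncoprime = valuation (signedTotal-noncoprime r′ s' b≡ r≡ s≡ maximal noncoprime n)
    where
    maximal : ∀ d → d * suc c ∣ ∣ r ∣ → d * suc c ∣ ∣ s ∣ → d * suc c ∣ b → d ≡ 1
    maximal d h₁ h₂ h₃ = ℕD.∣1⇒≡1 (ℕD.*-cancelʳ-∣ (suc c)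
      (subst (d * suc c ∣_) (sym (ℕP.*-identityˡ (suc c))) (greatest (gcd-greatest h₁ h₂) h₃)))
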